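{- For $i=0,1$ let $L_i$ be a multiset of integers congruent to $i\pmod 2$ and greater than $2$, and let $a\in\{0,1\}$. Set \[\epsilon_0=\max\Big(1,\ 2|L_0|\big(\max(L_0)+3\big)-1\Big),\qquad \epsilon_1=\max\Big(3,\ 7^{|L_1|+a-1}\big(2\max(L_1)+1\big)\Big).\] Then for every $\epsilon\ge 6\epsilon_0+7\epsilon_1+9$ there exists a graceful labeling $\Gamma$ of $\left[L_0,L_1,{}^a2\ \middle|\ \epsilon-\sum_{\ell\in L_0\cup L_1}\ell-2a\right]$ such that $\Delta_p\Gamma\supseteq\mathcal{I}(4\epsilon_0+5\epsilon_1+7,\ \epsilon)$.
   Context: $\mathcal{I}(a,b)=\{x\in\mathbb{Z}\mid a\le x\le b\}$; $|L|$ counts multiplicity; the maximum of an empty multiset is $0$; $L_0\cup L_1$ is the multiset union. $[L_0,L_1,{}^a2\mid m]$ is the vertex-disjoint union of one $\ell$-cycle for each $\ell\in L_0\cup L_1$, $a$ cycles of length $2$ (two vertices joined by two parallel edges), and a path with $m$ edges; its number of edges is $\epsilon=\sum\ell+2a+m$. A labeling is an isomorphic copy with distinct integer vertices; $\Delta\Gamma$ is the multiset of differences $u-w$ over ordered pairs of adjacent vertices (parallel edges counted separately), and $\Delta_p\Gamma$ is the same restricted to edges of the path. A graceful labeling of such a graph with $\epsilon$ edges is a labeling $\Gamma$ with vertex set $\mathcal{I}(0,\epsilon)$ such that $\Delta\Gamma=\pm\mathcal{I}(1,\epsilon)$ if there is no $2$-cycle, and $\Delta\Gamma=\pm\{1,3,3\}\cup\pm\mathcal{I}(4,\epsilon)$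 (as multisets) if there is exactly one $2$-cycle. -}

module Defs where

open import Data.Nat as ℕ using (ℕ; zero; suc; _∸_; _⊔_; _^_)
open import Data.Integer as ℤ using (ℤ; +_; _-_; -_)
open import Data.List using (List; []; _∷_; _++_; map; concat; concatMap; length; upTo; foldr)
open import Data.Nat.ListAction using (sum)
open import Data.List.Relation.Binary.Permutation.Propositional using (_↭_)
open import Data.List.Relation.Unary.All using (All)
open import Data.Vec using (Vec; toList)
open import Data.Product using (_×_; _,_; Σ)
open import Relation.Binary.PropositionalEquality using (_≡_)

-- Multisets are represented as lists; multiset equality is permutation (_↭_).

-- I(a,b) = {x | a ≤ x ≤ b} as a list of naturals (empty if b < a).
I : ℕ → ℕ → List ℕ
I a b = map (a ℕ.+_) (upTo (suc b ∸ a))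

-- maximum of a multiset of naturals; the maximum of the empty multiset is 0
maxL : List ℕ → ℕ
maxL = foldr _⊔_ 0

pm : List ℕ → List ℤ
pm = concatMap (λ x → + x ∷ - (+ x) ∷ [])

Even : ℕ → Set
Even n = Σ ℕ λ k → n ≡ k ℕ.* 2

Odd : ℕ → Set
Odd n = Σ ℕ λ k → n ≡ suc (k ℕ.* 2)

Edge : Set
Edge = ℤ × ℤ

pathEdges : List ℤ → List Edge
pathEdges []           = []
pathEdges (x ∷ [])     = []
pathEdges (x ∷ y ∷ xs) = (x , y) ∷ pathEdges (y ∷ xs)

cycleEdges : List ℤ → List Edge
cycleEdges []       = []
cycleEdges (x ∷ xs) = pathEdges (x ∷ xs ++ x ∷ [])

twoCycleEdges : ℤ × ℤ → List Edge
twoCycleEdges (u , w) = (u , w) ∷ (u , w) ∷ []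

Δ : List Edge → List ℤ
Δ = concatMap (λ { (u , w) → (u - w) ∷ (w - u) ∷ [] })

-- A labeling of [L₀, L₁, ^a 2 | m]: one cycle (vertex labels in cyclic order)
-- for each ℓ ∈ L₀ ∪ L₁ (listed in the order of L₀ ++ L₁), a 2-cycles, and a
-- path with m edges (m+1 vertices).  Distinctness of labels is required.
record Labeling (L₀ L₁ : List ℕ) (a m : ℕ) : Set where
  field
    cycles    : List (List ℤ)
    cycleLens : map length cycles ≡ L₀ ++ L₁
    twos      : Vec (ℤ × ℤ) a
    path      : List ℤ
    pathLen   : length path ≡ suc m

  vertices : List ℤ
  vertices = concat cycles ++ concatMap (λ { (u , w) → u ∷ w ∷ [] }) (toList twos) ++ path

  edges : List Edge
  edges = concatMap cycleEdges cycles ++ concatMap twoCycleEdges (toList twos) ++ pathEdges path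

  ΔΓ : List ℤ
  ΔΓ = Δ edges

  ΔpΓ : List ℤ
  ΔpΓ = Δ (pathEdges path)

open import Data.List.Relation.Unary.Unique.Propositional using (Unique)

numEdges : List ℕ → List ℕ → ℕ → ℕ → ℕ
numEdges L₀ L₁ a m = sum (L₀ ++ L₁) ℕ.+ 2 ℕ.* a ℕ.+ m

targetΔ : ℕ → ℕ → List ℤ
targetΔ zero    ε = pm (I 1 ε)
targetΔ (suc _) ε = pm (1 ∷ 3 ∷ 3 ∷ []) ++ pm (I 4 ε)

-- graceful labeling (graphs considered have a ≤ 1 two-cycles)
IsGraceful : {L₀ L₁ : List ℕ} {a m : ℕ} → Labeling L₀ L₁ a m → Set
IsGraceful {L₀} {L₁} {a} {m} Γ =
  Unique vertices ×
  vertices ↭ map +_ (I 0 ε) ×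
  ΔΓ ↭ targetΔ a ε
  where
    open Labeling Γ
    ε = numEdges L₀ L₁ a m

_⊆ₘ_ : List ℤ → List ℤ → Set
X ⊆ₘ Y = Σ (List ℤ) λ R → Y ↭ X ++ R

ε₀ : List ℕ → ℕ
ε₀ L₀ = 1 ⊔ (2 ℕ.* length L₀ ℕ.* (maxL L₀ ℕ.+ 3) ∸ 1)

ε₁ : List ℕ → ℕ → ℕ
ε₁ L₁ a = 3 ⊔ (7 ^ (length L₁ ℕ.+ a ∸ 1) ℕ.* (2 ℕ.* maxL L₁ ℕ.+ 1))

{-# OPTIONS --safe #-}

-- Around a graceful labeling of [0, N] put P new left vertices (depth x gets the label x) and Q new
-- right vertices (depth y gets the label n - y, where n = N + P + Q).  An edge between the two sides
-- has difference n - (x + y), so it suffices that the offsets x + y fill an initial interval.  If the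
-- path of the inner labeling ends at its vertex j, it can be wrapped in any such α-labeling whose path
-- ends at the depth j.
--
-- Even cycles: every even cycle has an α-labeling together with a path.  α-labelings with the same
-- frontier depth can be nested, and reversed; Euclid's algorithm on the depths of the two ends yields
-- paths with arbitrary ends, hence a common frontier for all even cycles, at linear cost.
--
-- Odd cycles: an odd cycle is an alternating strand closed through one more left vertex, with a single
-- left-left edge of difference N + 1, the smallest one not used inside.  Room for that edge makes one
-- such step multiply the number of edges by about 5, which the powers of 7 absorb.
module Submission where

open import Defs
open import Data.Nat using (ℕ; zero; suc; _+_; _*_; _∸_; _^_; _/_; _≤_; _<_; _>_; z≤n; s≤s)
open import Data.Nat.Properties
open import Data.Nat.DivMod using (m≡m%n+[m/n]*n; m%n<n; m/n*n≤m)
open import Data.Nat.ListAction using (sum)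
open import Data.Nat.ListAction.Properties using (sum-↭)
open import Data.Nat.Tactic.RingSolver using (solve; solve-∀)
open import Data.Integer as ℤ using (ℤ; ∣_∣; -[1+_]) renaming (+_ to pos)
open import Data.Integer.Properties using (+-injective; ∣-i∣≡∣i∣)
open import Data.Integer.Tactic.RingSolver using () renaming (solve-∀ to solveℤ-∀)
open import Data.Empty using (⊥; ⊥-elim)
open import Data.Product using (Σ; _×_; _,_; proj₁; proj₂)
open import Data.Sum using (_⊎_; inj₁; inj₂)
open import Data.Vec as Vec using (Vec; toList)
open import Data.List using (List; []; _∷_; _++_; map; concat; concatMap; length; upTo)
open import Data.List.Properties
  using (map-++; map-∘; map-id; concat-++; concat-map; concatMap-++; concatMap-cong; map-concatMap;
         ++-assoc; ++-identityʳ; length-++; length-map; upTo-∷ʳ)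
open import Data.List.Relation.Unary.All as All using (All)
open import Data.List.Relation.Unary.Unique.Propositional using (Unique)
open import Data.List.Relation.Unary.Unique.Propositional.Properties
  using (upTo⁺) renaming (map⁺ to Unique-map⁺)
open import Data.List.Relation.Binary.Permutation.Propositional
  using (_↭_; prep; swap; ↭-refl; ↭-sym; ↭-trans; ↭-reflexive; ↭⇒↭ₛ)
open import Data.List.Relation.Binary.Permutation.Propositional.Properties
  using (map⁺; ++⁺; ++⁺ˡ; ++⁺ʳ; ++-comm; shift; ↭-length; ↭-map-inv; All-resp-↭; ++-commutativeMonoid)
open import Relation.Binary.Definitions using (tri<; tri≈; tri>)
open import Relation.Binary.PropositionalEquality as ≡
  using (_≡_; refl; sym; trans; cong; cong₂; subst)
open import Data.List.Relation.Binary.Permutation.Setoid.Properties (≡.setoid ℤ) using (Unique-resp-↭)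
import Algebra.Solver.CommutativeMonoid as CommutativeMonoidSolver

-- Why `Alpha` has the shape it has: in a sum of all offsets each depth counts with the degree of
-- its vertex. So `2u - 1` edges on `u` vertices per side can have the offsets `0, ..., 2u - 2` only
-- if the ends of the path satisfy `s + e = u - 1`. The next free offset `2u - 1` is then
-- `s + u + e`. It is symmetric in the two ends, so the path can be continued inwards from either
-- one: from the right end to the left end `s` of an inner α-labeling, or from the left end to the
-- vertex `e` of a core.
--
-- The obstacle is parity. A layer with equally many vertices on both sides adds an even number of
-- edges, so even cycles and padding never change the parity of the total. Hence the odd step comes
-- in two versions that differ by one edge, and the parity of ε is settled before any even cycle is
-- inserted.
--
-- The other recurring difficulty is the frontier: each layer demands its own end vertex of the
-- inner path. The means to adjust it are reflection, which exchanges `j` and `N - j`, and padding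
-- by a path.

module Perm {A : Set} = CommutativeMonoidSolver (++-commutativeMonoid {A = A})
open Perm using (_⊕_; _⊜_)

-- Multisets that are intervals of naturals

-- Listed downwards, because the vertex and offset lists of a zigzag grow at the front with rising
-- values and so coincide with an `iv` literally.
iv : ℕ → ℕ → List ℕ
iv a zero    = []
iv a (suc n) = n + a ∷ iv a n

iv-++ : ∀ a m n → iv a (n + m) ≡ iv (m + a) n ++ iv a m
iv-++ a m zero    = refl
iv-++ a m (suc n) = cong₂ _∷_ (+-assoc n m a) (iv-++ a m n)

iv-shift : ∀ k a n → map (k +_) (iv a n) ≡ iv (k + a) n
iv-shift k a zero    = refl
iv-shift k a (suc n) = cong₂ _∷_ (solve (k ∷ n ∷ a ∷ [])) (iv-shift k a n)

iv-cons : ∀ a n → iv a (suc n) ↭ a ∷ iv (suc a) n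
iv-cons a zero    = ↭-refl
iv-cons a (suc n) =
  ↭-trans (prep (suc n + a) (iv-cons a n))
          (↭-trans (swap (suc n + a) a ↭-refl)
                   (prep a (↭-reflexive (cong (_∷ iv (suc a) n) (sym (+-suc n a))))))

-- Wrapped in a record so that `a` and `n` can be read off the type; unification cannot recover them
-- from `iv a n`.
record Tile (a n : ℕ) (xs : List ℕ) : Set where
  constructor tile
  field untile : xs ↭ iv a n
open Tile public

infixr 5 _then_by_
_then_by_ : ∀ {a m b n xs ys} → Tile a m xs → Tile b n ys → b ≡ m + a → Tile a (n + m) (ys ++ xs)
_then_by_ {a} {m} {n = n} (tile p) (tile q) refl = tile (↭-trans (++⁺ q p) (↭-reflexive (sym (iv-++ a m n))))

point : ∀ x → Tile x 1 (x ∷ [])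
point x = tile ↭-refl

retile : ∀ {a m n xs ys} → Tile a m xs → ys ↭ xs → m ≡ n → Tile a n ys
retile (tile p) q refl = tile (↭-trans q p)

-- The hypothesis is about the sum of the arguments instead of `c + m - 1 - x`, so no truncated
-- subtraction appears. Labels and differences are both instances.
iv-reflect : ∀ {A : Set} (f g : ℕ → A) c m → (∀ x y → suc (x + y) ≡ c + m → f x ≡ g y) →
             map f (iv 0 m) ↭ map g (iv c m)
iv-reflect f g c zero    fg = ↭-refl
iv-reflect f g c (suc m) fg =
  ↭-trans (++⁺ {x = f (m + 0) ∷ []}
               (↭-reflexive (cong (_∷ []) (fg (m + 0) c (solve (m ∷ c ∷ [])))))
               (iv-reflect f g (suc c) m λ x y e → fg x y (trans e (sym (+-suc c m)))))
          (map⁺ g (↭-sym (iv-cons c m)))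

-- Alternating paths

infixl 5 _▸_,_

-- Z s e is a path with an even number of vertices, alternating between the left and
-- the right side; the left end has depth s and the right end depth e.
data Z : ℕ → ℕ → Set where
  one   : (x y : ℕ) → Z x y
  _▸_,_ : ∀ {s e} → Z s e → (x y : ℕ) → Z s y

lefts rights offs : ∀ {s e} → Z s e → List ℕ
lefts (one x y)   = x ∷ []
lefts (z ▸ x , y) = x ∷ lefts z
rights (one x y)   = y ∷ []
rights (z ▸ x , y) = y ∷ rights z
offs (one x y)             = x + y ∷ []
offs (_▸_,_ {e = e} z x y) = x + y ∷ e + x ∷ offs z

pairs : ∀ {s e} → Z s e → ℕ
pairs (one x y)   = 1
pairs (z ▸ x , y) = suc (pairs z)

infixl 4 _⧺_
_⧺_ : ∀ {s e s' e'} → Z s e → Z s' e' → Z s e'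
z ⧺ one x y     = z ▸ x , y
z ⧺ (q ▸ x , y) = (z ⧺ q) ▸ x , y

lefts-⧺ : ∀ {s e s' e'} (z : Z s e) (q : Z s' e') → lefts (z ⧺ q) ≡ lefts q ++ lefts z
lefts-⧺ z (one x y)   = refl
lefts-⧺ z (q ▸ x , y) = cong (x ∷_) (lefts-⧺ z q)

rights-⧺ : ∀ {s e s' e'} (z : Z s e) (q : Z s' e') → rights (z ⧺ q) ≡ rights q ++ rights z
rights-⧺ z (one x y)   = refl
rights-⧺ z (q ▸ x , y) = cong (y ∷_) (rights-⧺ z q)

offs-⧺ : ∀ {s e s' e'} (z : Z s e) (q : Z s' e') → offs (z ⧺ q) ≡ offs q ++ (e + s') ∷ offs z
offs-⧺ z (one x y)   = refl
offs-⧺ {e = e} {s'} z (_▸_,_ {e = e'} q x y) = cong (λ l → x + y ∷ e' + x ∷ l) (offs-⧺ z q)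

pairs-⧺ : ∀ {s e s' e'} (z : Z s e) (q : Z s' e') → pairs (z ⧺ q) ≡ pairs q + pairs z
pairs-⧺ z (one x y)   = refl
pairs-⧺ z (q ▸ x , y) = cong suc (pairs-⧺ z q)

rev : ∀ {s e} → Z s e → Z e s
rev (one x y)   = one y x
rev (z ▸ x , y) = one y x ⧺ rev z

lefts-rev : ∀ {s e} (z : Z s e) → lefts (rev z) ↭ rights z
lefts-rev (one x y)   = ↭-refl
lefts-rev (z ▸ x , y) =
  ↭-trans (↭-reflexive (lefts-⧺ (one y x) (rev z)))
          (↭-trans (++-comm (lefts (rev z)) (y ∷ [])) (prep y (lefts-rev z)))

rights-rev : ∀ {s e} (z : Z s e) → rights (rev z) ↭ lefts z
rights-rev (one x y)   = ↭-refl
rights-rev (z ▸ x , y) =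
  ↭-trans (↭-reflexive (rights-⧺ (one y x) (rev z)))
          (↭-trans (++-comm (rights (rev z)) (x ∷ [])) (prep x (rights-rev z)))

offs-rev : ∀ {s e} (z : Z s e) → offs (rev z) ↭ offs z
offs-rev (one x y)   = ↭-reflexive (cong (_∷ []) (+-comm y x))
offs-rev (_▸_,_ {e = e} z x y) =
  ↭-trans (↭-reflexive (offs-⧺ (one y x) (rev z)))
          (↭-trans (++-comm (offs (rev z)) (x + e ∷ y + x ∷ []))
                   (↭-trans (swap _ _ (offs-rev z))
                            (↭-reflexive (cong₂ (λ a b → a ∷ b ∷ offs z) (+-comm y x) (+-comm x e)))))

pairs-rev : ∀ {s e} (z : Z s e) → pairs (rev z) ≡ pairs z
pairs-rev (one x y)   = refl
pairs-rev (z ▸ x , y) =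
  trans (pairs-⧺ (one y x) (rev z)) (trans (+-comm _ 1) (cong suc (pairs-rev z)))

up : ∀ k {s e} → Z s e → Z (k + s) (k + e)
up k (one x y)   = one (k + x) (k + y)
up k (z ▸ x , y) = up k z ▸ k + x , k + y

lefts-up : ∀ k {s e} (z : Z s e) → lefts (up k z) ≡ map (k +_) (lefts z)
lefts-up k (one x y)   = refl
lefts-up k (z ▸ x , y) = cong (k + x ∷_) (lefts-up k z)

rights-up : ∀ k {s e} (z : Z s e) → rights (up k z) ≡ map (k +_) (rights z)
rights-up k (one x y)   = refl
rights-up k (z ▸ x , y) = cong (k + y ∷_) (rights-up k z)

+-interchange : ∀ k x y → (k + x) + (k + y) ≡ (k + k) + (x + y)
+-interchange = solve-∀

offs-up : ∀ k {s e} (z : Z s e) → offs (up k z) ≡ map ((k + k) +_) (offs z)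
offs-up k (one x y) = cong (_∷ []) (+-interchange k x y)
offs-up k (_▸_,_ {e = e} z x y)
  = cong₂ _∷_ (+-interchange k x y) (cong₂ _∷_ (+-interchange k e x) (offs-up k z))

pairs-up : ∀ k {s e} (z : Z s e) → pairs (up k z) ≡ pairs z
pairs-up k (one x y)   = refl
pairs-up k (z ▸ x , y) = cong suc (pairs-up k z)

run : ∀ x y n → Z x (n + y)
run x y zero    = one x y
run x y (suc n) = run x y n ▸ suc n + x , suc n + y

lefts-run : ∀ x y n → lefts (run x y n) ≡ iv x (suc n)
lefts-run x y zero    = refl
lefts-run x y (suc n) = cong (suc n + x ∷_) (lefts-run x y n)

rights-run : ∀ x y n → rights (run x y n) ≡ iv y (suc n)
rights-run x y zero    = refl
rights-run x y (suc n) = cong (suc n + y ∷_) (rights-run x y n)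

offs-run : ∀ x y n → offs (run x y n) ≡ iv (x + y) (suc (n * 2))
offs-run x y zero    = refl
offs-run x y (suc n)
  rewrite offs-run x y n =
  cong₂ (λ a b → a ∷ b ∷ iv (x + y) (suc (n * 2))) (lem₁ x y n) (lem₂ x y n)
  where
  lem₁ : ∀ x y n → suc n + x + (suc n + y) ≡ suc (suc (n * 2)) + (x + y)
  lem₁ = solve-∀
  lem₂ : ∀ x y n → n + y + suc (n + x) ≡ suc (n * 2) + (x + y)
  lem₂ = solve-∀

pairs-run : ∀ x y n → pairs (run x y n) ≡ suc n
pairs-run x y zero    = refl
pairs-run x y (suc n) = cong suc (pairs-run x y n)

ext : ∀ n {s e} → Z s e → ℕ → Z s (n + e)
ext zero            z a = z
ext (suc n) {e = e} z a = ext n z a ▸ n + a , suc n + e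

lefts-ext : ∀ n {s e} (z : Z s e) a → lefts (ext n z a) ≡ iv a n ++ lefts z
lefts-ext zero    z a = refl
lefts-ext (suc n) z a = cong (n + a ∷_) (lefts-ext n z a)

rights-ext : ∀ n {s e} (z : Z s e) a → rights (ext n z a) ≡ iv (suc e) n ++ rights z
rights-ext zero    z a = refl
rights-ext (suc n) {e = e} z a = cong₂ _∷_ (sym (+-suc n e)) (rights-ext n z a)

offs-ext : ∀ n {s e} (z : Z s e) a → offs (ext n z a) ≡ iv (e + a) (n * 2) ++ offs z
offs-ext zero    z a = refl
offs-ext (suc n) {e = e} z a
  rewrite offs-ext n z a =
  cong₂ (λ b c → b ∷ c ∷ (iv (e + a) (n * 2) ++ offs z)) (lem₁ n e a) (lem₂ n e a)
  where
  lem₁ : ∀ n e a → n + a + suc (n + e) ≡ suc (n * 2) + (e + a)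
  lem₁ = solve-∀
  lem₂ : ∀ n e a → n + e + (n + a) ≡ n * 2 + (e + a)
  lem₂ = solve-∀

-- α-labelings

data Cyc : Set where
  cyc : ∀ {s e} → Z s e → Cyc

cleft cright coffs : Cyc → List ℕ
cleft (cyc z) = lefts z
cright (cyc z) = rights z
coffs (cyc {s} {e} z) = offs z ++ (e + s) ∷ []

clen : Cyc → ℕ
clen (cyc z) = 2 * pairs z

upᶜ : ℕ → Cyc → Cyc
upᶜ k (cyc z) = cyc (up k z)

revᶜ : Cyc → Cyc
revᶜ (cyc z) = cyc (rev z)

-- An α-labeling (all edges join the left to the right) of the cycles with lengths Ls and
-- a path, on u = s + e + 1 vertices per side; e + (u + s) is the offset left free for
-- joining the path to the next structure inwards.
record Alpha (s e : ℕ) (Ls : List ℕ) : Set where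
  field
    cs     : List Cyc
    lens   : map clen cs ≡ Ls
    path   : Z s e
  u = suc (s + e)
  field
    left↭  : Tile 0 u (concatMap cleft cs ++ lefts path)
    right↭ : Tile 0 u (concatMap cright cs ++ rights path)
    offs↭  : Tile 0 (u + u) (concatMap coffs cs ++ (e + (u + s)) ∷ offs path)

cleft-up : ∀ k cs → concatMap cleft (map (upᶜ k) cs) ≡ map (k +_) (concatMap cleft cs)
cleft-up k []           = refl
cleft-up k (cyc z ∷ cs) =
  trans (cong₂ _++_ (lefts-up k z) (cleft-up k cs)) (sym (map-++ (k +_) (lefts z) _))

cright-up : ∀ k cs → concatMap cright (map (upᶜ k) cs) ≡ map (k +_) (concatMap cright cs)
cright-up k []           = refl
cright-up k (cyc z ∷ cs) =
  trans (cong₂ _++_ (rights-up k z) (cright-up k cs)) (sym (map-++ (k +_) (rights z) _))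

coffs-up : ∀ k cs → concatMap coffs (map (upᶜ k) cs) ≡ map ((k + k) +_) (concatMap coffs cs)
coffs-up k []           = refl
coffs-up k (cyc {s} {e} z ∷ cs) =
  trans (cong₂ _++_ (trans (cong₂ (λ l x → l ++ x ∷ []) (offs-up k z) (+-interchange k e s))
                           (sym (map-++ ((k + k) +_) (offs z) _)))
                    (coffs-up k cs))
        (sym (map-++ ((k + k) +_) (coffs (cyc z)) _))

clen-up : ∀ k cs → map clen (map (upᶜ k) cs) ≡ map clen cs
clen-up k []           = refl
clen-up k (cyc z ∷ cs) = cong₂ _∷_ (cong (2 *_) (pairs-up k z)) (clen-up k cs)

cleft-rev : ∀ cs → concatMap cleft (map revᶜ cs) ↭ concatMap cright cs
cleft-rev []           = ↭-refl
cleft-rev (cyc z ∷ cs) = ++⁺ (lefts-rev z) (cleft-rev cs)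

cright-rev : ∀ cs → concatMap cright (map revᶜ cs) ↭ concatMap cleft cs
cright-rev []           = ↭-refl
cright-rev (cyc z ∷ cs) = ++⁺ (rights-rev z) (cright-rev cs)

coffs-rev : ∀ cs → concatMap coffs (map revᶜ cs) ↭ concatMap coffs cs
coffs-rev []           = ↭-refl
coffs-rev (cyc {s} {e} z ∷ cs) =
  ++⁺ (++⁺ (offs-rev z) (↭-reflexive (cong (_∷ []) (+-comm s e)))) (coffs-rev cs)

clen-rev : ∀ cs → map clen (map revᶜ cs) ≡ map clen cs
clen-rev []           = refl
clen-rev (cyc z ∷ cs) = cong₂ _∷_ (cong (2 *_) (pairs-rev z)) (clen-rev cs)

glue : ∀ c₁ {l₁} c₂ {l₂ m n} → Tile 0 m (c₁ ++ l₁) → Tile 0 n (c₂ ++ l₂) →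
       Tile 0 (n + m) ((c₁ ++ map (m +_) c₂) ++ (map (m +_) l₂ ++ l₁))
glue c₁ {l₁} c₂ {l₂} {m} {n} p (tile q) = retile
  (p then tile (↭-trans (↭-reflexive (sym (map-++ (m +_) c₂ l₂)))
                        (↭-trans (map⁺ (m +_) q) (↭-reflexive (iv-shift m 0 n)))) by refl)
  (Perm.solve 4 (λ a b c d → (a ⊕ b) ⊕ (c ⊕ d) ⊜ (b ⊕ c) ⊕ (a ⊕ d)) ↭-refl
     c₁ (map (m +_) c₂) (map (m +_) l₂) l₁)
  refl

infixl 6 _∘α_
-- The right end of the outer path is joined to the inner left end, which now lies at the depth
-- `A₁.u + s`. The offset of this edge is the one that the outer labeling left free, and this is why
-- both must share `s`.
_∘α_ : ∀ {s e₁ e₂ L₁ L₂} → Alpha s e₁ L₁ → Alpha s e₂ L₂ → Alpha s (suc (s + e₁) + e₂) (L₁ ++ L₂)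
_∘α_ {s} {e₁} {e₂} A₁ A₂ = record
  { cs     = A₁.cs ++ map (upᶜ A₁.u) A₂.cs
  ; lens   = trans (map-++ clen A₁.cs _) (cong₂ _++_ A₁.lens (trans (clen-up A₁.u A₂.cs) A₂.lens))
  ; path   = A₁.path ⧺ up A₁.u A₂.path
  ; left↭  = retile (glue (concatMap cleft A₁.cs) (concatMap cleft A₂.cs) A₁.left↭ A₂.left↭)
               (↭-reflexive (cong₂ _++_
               (trans (concatMap-++ cleft A₁.cs _) (cong (concatMap cleft A₁.cs ++_) (cleft-up A₁.u A₂.cs)))
               (trans (lefts-⧺ A₁.path _) (cong (_++ lefts A₁.path) (lefts-up A₁.u A₂.path))))) u-eq
  ; right↭ = retile (glue (concatMap cright A₁.cs) (concatMap cright A₂.cs) A₁.right↭ A₂.right↭)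
               (↭-reflexive (cong₂ _++_
               (trans (concatMap-++ cright A₁.cs _) (cong (concatMap cright A₁.cs ++_) (cright-up A₁.u A₂.cs)))
               (trans (rights-⧺ A₁.path _) (cong (_++ rights A₁.path) (rights-up A₁.u A₂.path))))) u-eq
  ; offs↭  = retile (glue (concatMap coffs A₁.cs) (concatMap coffs A₂.cs) A₁.offs↭ A₂.offs↭)
               (↭-reflexive (cong₂ _++_
               (trans (concatMap-++ coffs A₁.cs _) (cong (concatMap coffs A₁.cs ++_) (coffs-up A₁.u A₂.cs)))
               (cong₂ _∷_ port-eq (trans (offs-⧺ A₁.path _)
                                         (cong (_++ (e₁ + (A₁.u + s)) ∷ offs A₁.path) (offs-up A₁.u A₂.path)))))) uu-eq
  }
  where
  module A₁ = Alpha A₁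
  module A₂ = Alpha A₂
  u-eq : suc (s + e₂) + suc (s + e₁) ≡ suc (s + (suc (s + e₁) + e₂))
  u-eq = solve (s ∷ e₁ ∷ e₂ ∷ [])
  uu-eq : (suc (s + e₂) + suc (s + e₂)) + (suc (s + e₁) + suc (s + e₁)) ≡
          suc (s + (suc (s + e₁) + e₂)) + suc (s + (suc (s + e₁) + e₂))
  uu-eq = solve (s ∷ e₁ ∷ e₂ ∷ [])
  port-eq : suc (s + e₁) + e₂ + (suc (s + (suc (s + e₁) + e₂)) + s) ≡
            (suc (s + e₁) + suc (s + e₁)) + (e₂ + (suc (s + e₂) + s))
  port-eq = solve (s ∷ e₁ ∷ e₂ ∷ [])

revα : ∀ {s e L} → Alpha s e L → Alpha e s L
revα {s} {e} A = record
  { cs     = map revᶜ cs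
  ; lens   = trans (clen-rev cs) lens
  ; path   = rev path
  ; left↭  = retile right↭ (++⁺ (cleft-rev cs) (lefts-rev path)) u-eq
  ; right↭ = retile left↭ (++⁺ (cright-rev cs) (rights-rev path)) u-eq
  ; offs↭  = retile offs↭ (++⁺ (coffs-rev cs) (↭-trans (↭-reflexive (cong (_∷ offs (rev path)) port-eq))
                                                       (prep _ (offs-rev path))))
                    (cong₂ _+_ u-eq u-eq)
  }
  where
  open Alpha A
  u-eq : suc (s + e) ≡ suc (e + s)
  u-eq = cong suc (+-comm s e)
  port-eq : s + (suc (e + s) + e) ≡ e + (suc (s + e) + s)
  port-eq = solve (s ∷ e ∷ [])

-- Paths with prescribed end depths

castα : ∀ {s s' e e' L} → s ≡ s' → e ≡ e' → Alpha s e L → Alpha s' e' L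
castα refl refl A = A

run-lefts : ∀ x y n → Tile x (suc n) (lefts (run x y n))
run-lefts x y n = tile (↭-reflexive (lefts-run x y n))

run-rights : ∀ x y n → Tile y (suc n) (rights (run x y n))
run-rights x y n = tile (↭-reflexive (rights-run x y n))

run-offs : ∀ x y n → Tile (x + y) (suc (n * 2)) (offs (run x y n))
run-offs x y n = tile (↭-reflexive (offs-run x y n))

zigzag : ∀ e → Alpha 0 e []
zigzag e = castα refl (+-identityʳ e) (record
  { cs     = []
  ; lens   = refl
  ; path   = run 0 0 e
  ; left↭  = retile (run-lefts 0 0 e) ↭-refl (solve (e ∷ []))
  ; right↭ = retile (run-rights 0 0 e) ↭-refl (solve (e ∷ []))
  ; offs↭  = retile (run-offs 0 0 e then point (e + 0 + (suc (e + 0) + 0)) by solve (e ∷ [])) ↭-refl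
               (solve (e ∷ []))
  })

-- A zigzag descends from the left depth `s` to the right depth 0. The path then passes through the
-- left vertex 0 and the right vertex `2s`, and a second zigzag descends from the left depth `2s` to
-- the right depth `s`. The three edges in between have the offsets 0, `2s` and `4s`, which are the
-- gaps around the two runs.
diagonal : ∀ s → Alpha s s []
diagonal zero    = zigzag 0
diagonal (suc t) = castα (+-comm t 1) refl (record
  { cs     = []
  ; lens   = refl
  ; path   = (outer ▸ 0 , suc t + suc t) ⧺ inner
  ; left↭  = retile
      ((point 0 then retile (run-rights 0 1 t) (lefts-rev (run 0 1 t)) refl by refl)
         then retile (run-rights (suc t) (suc (suc t)) t) (lefts-rev (run (suc t) (suc (suc t)) t)) refl
         by solve (t ∷ []))
      (↭-trans (↭-reflexive (lefts-⧺ (outer ▸ 0 , suc t + suc t) inner))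
         (Perm.solve 3 (λ a b c → a ⊕ b ⊕ c ⊜ a ⊕ c ⊕ b) ↭-refl (lefts inner) (0 ∷ []) (lefts outer)))
      (solve (t ∷ []))
  ; right↭ = retile
      ((retile (run-lefts 0 1 t) (rights-rev (run 0 1 t)) refl
         then retile (run-lefts (suc t) (suc (suc t)) t) (rights-rev (run (suc t) (suc (suc t)) t)) refl
         by solve (t ∷ []))
         then point (suc t + suc t) by solve (t ∷ []))
      (↭-trans (↭-reflexive (rights-⧺ (outer ▸ 0 , suc t + suc t) inner))
         (Perm.solve 3 (λ a b c → a ⊕ b ⊕ c ⊜ b ⊕ a ⊕ c) ↭-refl
            (rights inner) (suc t + suc t ∷ []) (rights outer)))
      (solve (t ∷ []))
  ; offs↭  = retile
      (((((point 0
         then retile (run-offs 0 1 t) (offs-rev (run 0 1 t)) refl by refl)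
         then point (suc t + suc t) by solve (t ∷ []))
         then retile (run-offs (suc t) (suc (suc t)) t) (offs-rev (run (suc t) (suc (suc t)) t)) refl
         by solve (t ∷ []))
         then point (suc t + suc t + (t + suc (suc t))) by solve (t ∷ []))
         then point (suc t + (suc (t + 1 + suc t) + (t + 1))) by solve (t ∷ []))
      (↭-trans (↭-reflexive (cong (suc t + (suc (t + 1 + suc t) + (t + 1)) ∷_)
                                  (offs-⧺ (outer ▸ 0 , suc t + suc t) inner)))
         (Perm.solve 6 (λ a b c d e f → a ⊕ b ⊕ c ⊕ d ⊕ e ⊕ f ⊜ a ⊕ c ⊕ b ⊕ d ⊕ f ⊕ e) ↭-refl
            (suc t + (suc (t + 1 + suc t) + (t + 1)) ∷ []) (offs inner)
            (suc t + suc t + (t + suc (suc t)) ∷ [])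
            (suc t + suc t ∷ []) (0 ∷ []) (offs outer)))
      (solve (t ∷ []))
  })
  where
  outer = rev (run 0 1 t)
  inner = rev (run (suc t) (suc (suc t)) t)

-- Subtractive Euclid: the reversed zigzag from `s` to 0 occupies `s + 1` depths per side, so
-- putting it outside lowers the larger end by `s + 1`. Reversal exchanges the ends, and equal ends
-- are `diagonal`. The first argument of `go` is fuel.
pad : ∀ s e → Alpha s e []
pad s e = go (s + e) s e (≤-reflexive refl)
  where
  strip-size : ∀ s d → suc (s + s + d) ≡ s + (suc s + d)
  strip-size = solve-∀
  go : ∀ n s e → s + e ≤ n → Alpha s e []
  strip : ∀ n s d → suc (s + s + d) ≤ n → Alpha s (suc (s + d)) []
  strip (suc n) s d (s≤s h) = castα refl (cong (λ x → suc (x + d)) (+-identityʳ s))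
    (revα (zigzag s) ∘α go n s d (≤-trans (+-monoˡ-≤ d (m≤m+n s s)) h))
  go n s e h with <-cmp s e
  ... | tri≈ _ refl _ = diagonal s
  ... | tri< s<e _ _ with d , refl ← m≤n⇒∃[o]m+o≡n s<e =
        strip n s d (≤-trans (≤-reflexive (strip-size s d)) h)
  ... | tri> _ _ e<s with d , refl ← m≤n⇒∃[o]m+o≡n e<s =
        revα (strip n e d (≤-trans (≤-reflexive (trans (strip-size e d) (+-comm e _))) h))

-- With k = t + 1, the runs A, B, C and the pair of depths (k, 3k) make up both the 4k-cycle A C with the
-- path (k, 3k) B and the (4k + 2)-cycle A (k, 3k) B with the path C.
module EvenGadget (t : ℕ) where
  A = run 0 0 t
  B = rev (run (suc t + suc t) (suc (suc t + suc t)) t)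
  C = run (suc (suc t)) (suc t) t

  B-lefts : Tile (suc (suc t + suc t)) (suc t) (lefts B)
  B-lefts = retile (run-rights (suc t + suc t) _ t) (lefts-rev _) refl
  B-rights : Tile (suc t + suc t) (suc t) (rights B)
  B-rights = retile (run-lefts (suc t + suc t) (suc (suc t + suc t)) t) (rights-rev _) refl
  B-offs : Tile (suc t + suc t + suc (suc t + suc t)) (suc (t * 2)) (offs B)
  B-offs = retile (run-offs (suc t + suc t) _ t) (offs-rev _) refl

  all-lefts : Tile 0 (suc t + (suc t + (1 + suc t))) (lefts B ++ lefts C ++ suc t ∷ lefts A)
  all-lefts = ((run-lefts 0 0 t then point (suc t) by solve (t ∷ []))
                 then run-lefts (suc (suc t)) (suc t) t by solve (t ∷ []))
                 then B-lefts by solve (t ∷ [])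

  all-rights : Tile 0 (1 + (suc t + (suc t + suc t))) (suc t + (suc t + suc t) ∷ rights B ++ rights C ++ rights A)
  all-rights = ((run-rights 0 0 t then run-rights (suc (suc t)) (suc t) t by solve (t ∷ []))
                  then B-rights by solve (t ∷ []))
                  then point (suc t + (suc t + suc t)) by solve (t ∷ [])

  -- Both labelings use the same single edges between the runs. The offsets `2k - 1` and `2k` are
  -- the two edges leaving `A`, and only their roles differ: one joins `A` to what follows, the
  -- other closes the cycle. `4k` and `6k` are the edges at the right vertex `3k`, and `6k + 1` is
  -- the free offset.
  all-offs : ∀ {a b c d p} → a ≡ suc (t * 2) → b ≡ suc t + suc t → c ≡ 4 * suc t → d ≡ 6 * suc t →
    p ≡ suc (6 * suc t) →
    Tile 0 (2 * suc (3 * suc t)) (p ∷ d ∷ offs B ++ c ∷ offs C ++ b ∷ a ∷ offs A)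
  all-offs refl refl refl refl refl = retile
    (((((((run-offs 0 0 t
      then point (suc (t * 2)) by solve (t ∷ []))
      then point (suc t + suc t) by solve (t ∷ []))
      then run-offs (suc (suc t)) (suc t) t by solve (t ∷ []))
      then point (4 * suc t) by solve (t ∷ []))
      then B-offs by solve (t ∷ []))
      then point (6 * suc t) by solve (t ∷ []))
      then point (suc (6 * suc t)) by solve (t ∷ []))
    ↭-refl (solve (t ∷ []))

  cycle₀ : Alpha (suc t) (suc t + suc t) (4 * suc t ∷ [])
  cycle₀ = record
    { cs     = cyc (A ⧺ C) ∷ []
    ; lens   = cong (_∷ []) (trans (cong (2 *_) (trans (pairs-⧺ A C)
                 (cong₂ _+_ (pairs-run (suc (suc t)) (suc t) t) (pairs-run 0 0 t)))) (solve (t ∷ [])))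
    ; path   = stem ⧺ B
    ; left↭  = retile all-lefts
        (↭-trans (↭-reflexive (cong₂ (λ x y → (x ++ []) ++ y) (lefts-⧺ A C) (lefts-⧺ stem B)))
          (Perm.solve 4 (λ a b c d → ((a ⊕ b) ⊕ Perm.id) ⊕ (c ⊕ d) ⊜ c ⊕ a ⊕ d ⊕ b) ↭-refl
            (lefts C) (lefts A) (lefts B) (suc t ∷ [])))
        (solve (t ∷ []))
    ; right↭ = retile all-rights
        (↭-trans (↭-reflexive (cong₂ (λ x y → (x ++ []) ++ y) (rights-⧺ A C) (rights-⧺ stem B)))
          (Perm.solve 4 (λ a b c d → ((a ⊕ b) ⊕ Perm.id) ⊕ (c ⊕ d) ⊜ d ⊕ c ⊕ a ⊕ b) ↭-refl
            (rights C) (rights A) (rights B) (suc t + (suc t + suc t) ∷ [])))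
        (solve (t ∷ []))
    ; offs↭  = retile
        (all-offs {t + suc t + 0} {t + 0 + suc (suc t)} {suc t + (suc t + (suc t + suc t))}
                  {suc t + (suc t + suc t) + (t + suc (suc t + suc t))} {port}
                  (solve (t ∷ [])) (solve (t ∷ [])) (solve (t ∷ [])) (solve (t ∷ [])) port-eq)
        (↭-trans (↭-reflexive (cong₂ (λ x y → ((x ++ (t + suc t + 0) ∷ []) ++ []) ++ port ∷ y)
                                     (offs-⧺ A C) (offs-⧺ stem B)))
          (Perm.solve 8 (λ a b c d e f g h → (((a ⊕ b ⊕ c) ⊕ d) ⊕ Perm.id) ⊕ (e ⊕ f ⊕ g ⊕ h) ⊜
                                             e ⊕ g ⊕ f ⊕ h ⊕ a ⊕ b ⊕ d ⊕ c) ↭-refl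
            (offs C) (t + 0 + suc (suc t) ∷ []) (offs A) (t + suc t + 0 ∷ []) (port ∷ []) (offs B)
            (suc t + (suc t + suc t) + (t + suc (suc t + suc t)) ∷ []) (suc t + (suc t + (suc t + suc t)) ∷ [])))
        (solve (t ∷ []))
    }
    where
    stem = one (suc t) (suc t + (suc t + suc t))
    port = suc t + suc t + (suc (suc t + (suc t + suc t)) + suc t)
    port-eq : suc t + suc t + (suc (suc t + (suc t + suc t)) + suc t) ≡ suc (6 * suc t)
    port-eq = solve (t ∷ [])

  cycle₂ : Alpha (suc (suc t)) (t + suc t) (2 + 4 * suc t ∷ [])
  cycle₂ = record
    { cs     = cyc (start ⧺ B) ∷ []
    ; lens   = cong (_∷ []) (trans (cong (2 *_) (trans (pairs-⧺ start B)
                 (cong₂ (λ x y → x + suc y)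
                        (trans (pairs-rev (run (suc t + suc t) (suc (suc t + suc t)) t)) (pairs-run (suc t + suc t) _ t))
                        (pairs-run 0 0 t)))) (solve (t ∷ [])))
    ; path   = C
    ; left↭  = retile all-lefts
        (↭-trans (↭-reflexive (cong (λ x → (x ++ []) ++ lefts C) (lefts-⧺ start B)))
          (Perm.solve 4 (λ a b c d → ((c ⊕ d ⊕ b) ⊕ Perm.id) ⊕ a ⊜ c ⊕ a ⊕ d ⊕ b) ↭-refl
            (lefts C) (lefts A) (lefts B) (suc t ∷ [])))
        (solve (t ∷ []))
    ; right↭ = retile all-rights
        (↭-trans (↭-reflexive (cong (λ x → (x ++ []) ++ rights C) (rights-⧺ start B)))
          (Perm.solve 4 (λ a b c d → ((c ⊕ d ⊕ b) ⊕ Perm.id) ⊕ a ⊜ d ⊕ c ⊕ a ⊕ b) ↭-refl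
            (rights C) (rights A) (rights B) (suc t + (suc t + suc t) ∷ [])))
        (solve (t ∷ []))
    ; offs↭  = retile
        (all-offs {t + 0 + suc t} {suc t + suc t + 0} {suc t + (suc t + (suc t + suc t))}
                  {suc t + (suc t + suc t) + (t + suc (suc t + suc t))} {port}
                  (solve (t ∷ [])) (solve (t ∷ [])) (solve (t ∷ [])) (solve (t ∷ [])) port-eq)
        (↭-trans (↭-reflexive (cong (λ x → ((x ++ (suc t + suc t + 0) ∷ []) ++ []) ++ port ∷ offs C)
                                    (offs-⧺ start B)))
          (Perm.solve 8 (λ oC oA oB a b c d p → (((oB ⊕ d ⊕ c ⊕ a ⊕ oA) ⊕ b) ⊕ Perm.id) ⊕ (p ⊕ oC) ⊜
                                                p ⊕ d ⊕ oB ⊕ c ⊕ oC ⊕ b ⊕ a ⊕ oA) ↭-refl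
            (offs C) (offs A) (offs B) (t + 0 + suc t ∷ []) (suc t + suc t + 0 ∷ [])
            (suc t + (suc t + (suc t + suc t)) ∷ [])
            (suc t + (suc t + suc t) + (t + suc (suc t + suc t)) ∷ []) (port ∷ [])))
        (solve (t ∷ []))
    }
    where
    start = A ▸ suc t , suc t + (suc t + suc t)
    port = t + suc t + (suc (suc (suc t) + (t + suc t)) + suc (suc t))
    port-eq : t + suc t + (suc (suc (suc t) + (t + suc t)) + suc (suc t)) ≡ suc (6 * suc t)
    port-eq = solve (t ∷ [])

castL : ∀ {s e L L'} → L ≡ L' → Alpha s e L → Alpha s e L'
castL refl A = A

-- The frontier κ of the labelings above depends on the length of the cycle; padding and reversing
-- turns it into a frontier J that all even cycles can share.
widen : ∀ {κ e g L} J → κ + e ≡ 3 * g → 3 * g < J → Alpha κ e L → Alpha J κ L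
widen {κ} {e} {g} J e≡ h A with d , refl ← m≤n⇒∃[o]m+o≡n h =
  castα (cong (λ x → suc (x + d)) e≡) refl (revα (castL (++-identityʳ _) (A ∘α pad κ d)))

halve : ∀ n → Σ ℕ λ m → (n ≡ m + m) ⊎ (n ≡ suc (m + m))
halve zero = 0 , inj₁ refl
halve (suc n) with halve n
... | m , inj₁ refl = m , inj₂ refl
... | m , inj₂ refl = suc m , inj₁ (cong suc (sym (+-suc m m)))

quarter : ∀ {m n} → 4 * m ≤ 3 + 4 * n → m ≤ n
quarter {m} {n} h = ≤-pred (*-cancelˡ-< 4 m (suc n) (≤-trans (s≤s h) (≤-reflexive (lem n))))
  where
  lem : ∀ n → suc (3 + 4 * n) ≡ 4 * suc n
  lem = solve-∀

evenPiece₀ : ∀ K t → suc t ≤ K → Alpha (suc (3 * K)) (suc t) ((suc t + suc t) * 2 ∷ [])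
evenPiece₀ K t t<K = widen {g = suc t} _ (e-eq t) (s≤s (*-monoʳ-≤ 3 t<K))
                           (castL (cong (_∷ []) (len-eq t)) (EvenGadget.cycle₀ t))
  where
  len-eq : ∀ t → 4 * suc t ≡ (suc t + suc t) * 2
  len-eq = solve-∀
  e-eq : ∀ t → suc t + (suc t + suc t) ≡ 3 * suc t
  e-eq = solve-∀

evenPiece₂ : ∀ K t → suc t ≤ K → Alpha (suc (3 * K)) (suc (suc t)) (suc (suc t + suc t) * 2 ∷ [])
evenPiece₂ K t t<K = widen {g = suc t} _ (e-eq t) (s≤s (*-monoʳ-≤ 3 t<K))
                           (castL (cong (_∷ []) (len-eq t)) (EvenGadget.cycle₂ t))
  where
  len-eq : ∀ t → 2 + 4 * suc t ≡ suc (suc t + suc t) * 2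
  len-eq = solve-∀
  e-eq : ∀ t → suc (suc t) + (t + suc t) ≡ 3 * suc t
  e-eq = solve-∀

evenPiece : ∀ K ℓ → Even ℓ × 2 < ℓ → ℓ ≤ 3 + 4 * K →
            Σ ℕ λ κ → κ ≤ suc K × Alpha (suc (3 * K)) κ (ℓ ∷ [])
evenPiece K ℓ ((i , refl) , 2<ℓ) ℓ≤ with halve i
evenPiece K ℓ ((i , refl) , ()) ℓ≤ | zero , inj₁ refl
evenPiece K ℓ ((i , refl) , s≤s (s≤s ())) ℓ≤ | zero , inj₂ refl
... | suc t , inj₁ refl = suc t , m≤n⇒m≤1+n t<K , evenPiece₀ K t t<K
  where
  lem : ∀ t → 4 * suc t ≡ (suc t + suc t) * 2
  lem = solve-∀
  t<K : suc t ≤ K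
  t<K = quarter (≤-trans (≤-reflexive (lem t)) ℓ≤)
... | suc t , inj₂ refl = suc (suc t) , s≤s t<K , evenPiece₂ K t t<K
  where
  lem : ∀ t → 2 + 4 * suc t ≡ suc (suc t + suc t) * 2
  lem = solve-∀
  t<K : suc t ≤ K
  t<K = quarter (≤-trans (m≤n+m _ 2) (≤-trans (≤-reflexive (lem t)) ℓ≤))

-- Each cycle raises the right end by `2 + 3K + κ`, at most `3 + 4K`. The chain ends in an arbitrary
-- `pad`, so every depth from `U` on can be reached, not only `U`.
evenChain : ∀ K L → All (λ ℓ → Even ℓ × 2 < ℓ) L → All (_≤ 3 + 4 * K) L →
            Σ ℕ λ U → U ≤ length L * (3 + 4 * K) × (∀ d → Alpha (suc (3 * K)) (U + d) L)
evenChain K []      All.[]            All.[]          = 0 , z≤n , pad _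
evenChain K (ℓ ∷ L) (ev All.∷ evs) (b All.∷ bs) with evenPiece K ℓ ev b | evenChain K L evs bs
... | κ , κ≤ , A | U , U≤ , As = suc (suc (3 * K) + κ) + U ,
  +-mono-≤ (≤-trans (+-monoʳ-≤ (2 + 3 * K) κ≤) (≤-reflexive (lem K))) U≤ ,
  λ d → castα refl (sym (+-assoc (suc (suc (3 * K) + κ)) U d)) (A ∘α As d)
  where
  lem : ∀ K → 2 + 3 * K + suc K ≡ 3 + 4 * K
  lem = solve-∀

-- Graceful labelings with a distinguished path end

dist : Edge → ℕ
dist (x , y) = ∣ x ℤ.- y ∣

pathDists cycleDists : List ℤ → List ℕ
pathDists xs = map dist (pathEdges xs)
cycleDists xs = map dist (cycleEdges xs)

twoVerts : ∀ {a} → Vec (ℤ × ℤ) a → List ℤ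
twoVerts ts = concatMap (λ { (x , y) → x ∷ y ∷ [] }) (toList ts)

twoDists : ∀ {a} → Vec (ℤ × ℤ) a → List ℕ
twoDists ts = map dist (concatMap twoCycleEdges (toList ts))

differences : ℕ → ℕ → List ℕ
differences zero    N = iv 1 N
differences (suc _) N = 1 ∷ 3 ∷ 3 ∷ iv 4 (N ∸ 3)

-- With a 2-cycle the difference 3 occurs twice and 2 is missing. From `N = 3` on this defect lies
-- below all new differences and `N ∸ 3` is not truncated.
differences-+ : ∀ a N m → 3 * a ≤ N → iv (suc N) m ++ differences a N ↭ differences a (m + N)
differences-+ zero    N m _ = ↭-reflexive (sym (trans (iv-++ 1 N m) (cong (λ x → iv x m ++ iv 1 N) (+-comm N 1))))
differences-+ (suc a) N m h =
  ↭-trans (Perm.solve 3 (λ x y z → x ⊕ y ⊕ z ⊜ y ⊕ x ⊕ z) ↭-refl (iv (suc N) m) (1 ∷ 3 ∷ 3 ∷ []) (iv 4 (N ∸ 3)))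
    (↭-reflexive (cong (λ l → 1 ∷ 3 ∷ 3 ∷ l)
      (trans (cong (λ x → iv x m ++ iv 4 (N ∸ 3)) N-eq)
             (trans (sym (iv-++ 4 (N ∸ 3) m)) (cong (iv 4) (sym (+-∸-assoc m 3≤N)))))))
  where
  3≤N : 3 ≤ N
  3≤N = ≤-trans (m≤m*n 3 (suc a)) h
  N-eq : suc N ≡ N ∸ 3 + 4
  N-eq = trans (cong suc (sym (m∸n+n≡m 3≤N))) (sym (+-suc (N ∸ 3) 3))

-- A graceful labeling with N edges (and a 2-cycles) whose path starts at the vertex j.
record Core (a N j : ℕ) (Ls : List ℕ) : Set where
  field
    cycles : List (List ℤ)
    lens   : map length cycles ↭ Ls
    twos   : Vec (ℤ × ℤ) a
    tail   : List ℤ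
  path = pos j ∷ tail
  field
    verts  : concat cycles ++ twoVerts twos ++ path ↭ map pos (iv 0 (suc N))
    dists  : concatMap cycleDists cycles ++ twoDists twos ++ pathDists path ↭ differences a N
    large  : 3 * a ≤ N

module Isometry (f : ℤ → ℤ) (iso : ∀ x y → dist (f x , f y) ≡ dist (x , y)) where

  pathDists-map : ∀ xs → pathDists (map f xs) ≡ pathDists xs
  pathDists-map []           = refl
  pathDists-map (x ∷ [])     = refl
  pathDists-map (x ∷ y ∷ xs) = cong₂ _∷_ (iso x y) (pathDists-map (y ∷ xs))

  cycleDists-map : ∀ xs → cycleDists (map f xs) ≡ cycleDists xs
  cycleDists-map []       = refl
  cycleDists-map (x ∷ xs) =
    trans (cong (λ l → pathDists (f x ∷ l)) (sym (map-++ f xs (x ∷ [])))) (pathDists-map (x ∷ xs ++ x ∷ []))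

  cyclesDists-map : ∀ cs → concatMap cycleDists (map (map f) cs) ≡ concatMap cycleDists cs
  cyclesDists-map []       = refl
  cyclesDists-map (c ∷ cs) = cong₂ _++_ (cycleDists-map c) (cyclesDists-map cs)

  lens-map : ∀ cs → map length (map (map f) cs) ≡ map length cs
  lens-map []       = refl
  lens-map (c ∷ cs) = cong₂ _∷_ (length-map f c) (lens-map cs)

  f₂ : ℤ × ℤ → ℤ × ℤ
  f₂ (x , y) = f x , f y

  twoVerts-map : ∀ {a} (ts : Vec (ℤ × ℤ) a) → twoVerts (Vec.map f₂ ts) ≡ map f (twoVerts ts)
  twoVerts-map Vec.[]             = refl
  twoVerts-map ((x , y) Vec.∷ ts) = cong (λ l → f x ∷ f y ∷ l) (twoVerts-map ts)

  twoDists-map : ∀ {a} (ts : Vec (ℤ × ℤ) a) → twoDists (Vec.map f₂ ts) ≡ twoDists ts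
  twoDists-map Vec.[]             = refl
  twoDists-map ((x , y) Vec.∷ ts) = cong₂ (λ d l → d ∷ d ∷ l) (iso x y) (twoDists-map ts)

  verts-map : ∀ {a} cs (ts : Vec (ℤ × ℤ) a) p →
    concat (map (map f) cs) ++ twoVerts (Vec.map f₂ ts) ++ map f p ≡ map f (concat cs ++ twoVerts ts ++ p)
  verts-map cs ts p = trans (cong₂ _++_ (concat-map cs)
                               (trans (cong (_++ map f p) (twoVerts-map ts)) (sym (map-++ f (twoVerts ts) p))))
                            (sym (map-++ f (concat cs) _))

  dists-map : ∀ {a} cs (ts : Vec (ℤ × ℤ) a) p →
    concatMap cycleDists (map (map f) cs) ++ twoDists (Vec.map f₂ ts) ++ pathDists (map f p) ≡
    concatMap cycleDists cs ++ twoDists ts ++ pathDists p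
  dists-map cs ts p = cong₂ _++_ (cyclesDists-map cs) (cong₂ _++_ (twoDists-map ts) (pathDists-map p))

reflect-iso : ∀ n x y → dist (n ℤ.- x , n ℤ.- y) ≡ dist (x , y)
reflect-iso n x y = trans (cong ∣_∣ (lem n x y)) (∣-i∣≡∣i∣ (x ℤ.- y))
  where
  lem : ∀ n x y → (n ℤ.- x) ℤ.- (n ℤ.- y) ≡ ℤ.- (x ℤ.- y)
  lem = solveℤ-∀

shift-iso : ∀ k x y → dist (k ℤ.+ x , k ℤ.+ y) ≡ dist (x , y)
shift-iso k x y = cong ∣_∣ (lem k x y)
  where
  lem : ∀ k x y → (k ℤ.+ x) ℤ.- (k ℤ.+ y) ≡ x ℤ.- y
  lem = solveℤ-∀

reflect-iv : ∀ c m → map (λ x → pos (c + m) ℤ.- pos x) (iv 0 m) ↭ map pos (iv (suc c) m)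
reflect-iv c m = iv-reflect _ pos (suc c) m λ x y e →
  trans (cong (λ z → pos z ℤ.- pos x) (sym (suc-injective e))) (lem (pos x) (pos y))
  where
  lem : ∀ x y → (x ℤ.+ y) ℤ.- x ≡ y
  lem = solveℤ-∀

flip : ∀ {a N j Ls} J → J + j ≡ N → Core a N j Ls → Core a N J Ls
flip {N = N} {j} J J+j≡N c = record
  { cycles = map (map f) cycles
  ; lens   = ↭-trans (↭-reflexive (lens-map cycles)) lens
  ; twos   = Vec.map f₂ twos
  ; tail   = map f tail
  ; verts  = ↭-trans (↭-reflexive (trans
              (cong (λ x → concat (map (map f) cycles) ++ twoVerts (Vec.map f₂ twos) ++ x ∷ map f tail) (sym f-j))
                                         (verts-map cycles twos path)))
               (↭-trans (map⁺ f verts)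
                 (↭-trans (↭-reflexive (sym (map-∘ (iv 0 (suc N)))))
                          (iv-reflect _ pos 0 (suc N) λ x y e →
                            trans (cong (λ z → pos z ℤ.- pos x) (sym (suc-injective e))) (lem′ (pos x) (pos y)))))
  ; dists  = ↭-trans (↭-reflexive (trans
              (cong (λ x → concatMap cycleDists (map (map f) cycles) ++ twoDists (Vec.map f₂ twos) ++
                                                                pathDists (x ∷ map f tail)) (sym f-j))
                                         (dists-map cycles twos path))) dists
  ; large  = large
  }
  where
  open Core c
  f : ℤ → ℤ
  f x = pos N ℤ.- x
  open Isometry f (reflect-iso (pos N))
  lem : ∀ x y → (x ℤ.+ y) ℤ.- y ≡ x
  lem = solveℤ-∀
  lem′ : ∀ x y → (x ℤ.+ y) ℤ.- x ≡ y
  lem′ = solveℤ-∀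
  f-j : f (pos j) ≡ pos J
  f-j = trans (cong (λ z → pos z ℤ.- pos j) (sym J+j≡N)) (lem (pos J) (pos j))

-- Wrapping new vertices around a core

offDist : ℕ → ℕ → ℕ
offDist n o = ∣ pos n ℤ.- pos o ∣

-- The labels are the mirror image of those in the overview: a right depth `y` gets `y`, a left
-- depth `x` gets `n - x`. The list begins at the right end, so its label `e` becomes the frontier
-- of the enlarged core.
labTail lab : ∀ (n : ℕ) {s e} → Z s e → List ℤ
lab n {e = e} z = pos e ∷ labTail n z
labTail n (one x y)   = pos n ℤ.- pos x ∷ []
labTail n (z ▸ x , y) = pos n ℤ.- pos x ∷ lab n z

lab-verts : ∀ n {s e} (z : Z s e) →
  lab n z ↭ map pos (rights z) ++ map (λ x → pos n ℤ.- pos x) (lefts z)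
lab-verts n (one x y)   = ↭-refl
lab-verts n (z ▸ x , y) = prep (pos y) (↭-trans (prep _ (lab-verts n z)) (↭-sym (shift _ (map pos (rights z)) _)))

length-lab : ∀ n {s e} (z : Z s e) → length (lab n z) ≡ 2 * pairs z
length-lab n (one x y)   = refl
length-lab n (z ▸ x , y) = trans (cong (2 +_) (length-lab n z)) (sym (*-suc 2 (pairs z)))

dist-right-left : ∀ n x y → dist (pos y , pos n ℤ.- pos x) ≡ offDist n (x + y)
dist-right-left n x y = trans (cong ∣_∣ (lem (pos n) (pos x) (pos y))) (∣-i∣≡∣i∣ (pos n ℤ.- pos (x + y)))
  where
  lem : ∀ n x y → y ℤ.- (n ℤ.- x) ≡ ℤ.- (n ℤ.- (x ℤ.+ y))
  lem = solveℤ-∀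

dist-left-right : ∀ n x y → dist (pos n ℤ.- pos x , pos y) ≡ offDist n (y + x)
dist-left-right n x y = cong ∣_∣ (lem (pos n) (pos x) (pos y))
  where
  lem : ∀ n x y → (n ℤ.- x) ℤ.- y ≡ n ℤ.- (y ℤ.+ x)
  lem = solveℤ-∀

lab-dists : ∀ n {s e} (z : Z s e) v vs →
  pathDists (lab n z ++ v ∷ vs) ≡ map (offDist n) (offs z) ++ dist (pos n ℤ.- pos s , v) ∷ pathDists (v ∷ vs)
lab-dists n (one x y) v vs = cong (_∷ _) (dist-right-left n x y)
lab-dists n (_▸_,_ {e = e} z x y) v vs =
  cong₂ _∷_ (dist-right-left n x y) (cong₂ _∷_ (dist-left-right n x e) (lab-dists n z v vs))

labᶜ : ℕ → Cyc → List ℤ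
labᶜ n (cyc z) = lab n z

labᶜ-verts : ∀ n cs → concat (map (labᶜ n) cs) ↭
  map pos (concatMap cright cs) ++ map (λ x → pos n ℤ.- pos x) (concatMap cleft cs)
labᶜ-verts n []           = ↭-refl
labᶜ-verts n (cyc z ∷ cs) = ↭-trans (++⁺ (lab-verts n z) (labᶜ-verts n cs))
  (↭-trans (Perm.solve 4 (λ a b c d → (a ⊕ b) ⊕ (c ⊕ d) ⊜ (a ⊕ c) ⊕ (b ⊕ d)) ↭-refl
             (map pos (rights z)) (map g (lefts z)) (map pos (concatMap cright cs)) (map g (concatMap cleft cs)))
           (↭-reflexive (sym (cong₂ _++_ (map-++ pos (rights z) _) (map-++ g (lefts z) _)))))
  where
  g : ℕ → ℤ
  g x = pos n ℤ.- pos x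

labᶜ-dists : ∀ n cs → concatMap cycleDists (map (labᶜ n) cs) ≡ map (offDist n) (concatMap coffs cs)
labᶜ-dists n []                   = refl
labᶜ-dists n (cyc {s} {e} z ∷ cs) = trans
  (cong₂ _++_ (trans (lab-dists n z (pos e) [])
                     (trans (cong (λ d → map (offDist n) (offs z) ++ d ∷ []) (dist-left-right n s e))
                            (sym (map-++ (offDist n) (offs z) _))))
              (labᶜ-dists n cs))
  (sym (map-++ (offDist n) (coffs (cyc z)) _))

labᶜ-lens : ∀ n cs → map length (map (labᶜ n) cs) ≡ map clen cs
labᶜ-lens n []           = refl
labᶜ-lens n (cyc z ∷ cs) = cong₂ _∷_ (length-lab n z) (labᶜ-lens n cs)

reflect-offs : ∀ N m → map (offDist (N + m)) (iv 0 m) ↭ iv (suc N) m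
reflect-offs N m = ↭-trans (iv-reflect (offDist (N + m)) (λ y → y) (suc N) m λ x y e →
    trans (cong (λ z → offDist z x) (sym (suc-injective e))) (cong ∣_∣ (lem (pos x) (pos y))))
  (↭-reflexive (map-id _))
  where
  lem : ∀ x y → (x ℤ.+ y) ℤ.- x ≡ y
  lem = solveℤ-∀

-- The labels fall into three blocks: the right vertices below `Q`, the core shifted to
-- `Q, ..., Q + N`, and the left vertices above it.
surround : ∀ {N} P Q {ls rs vs cvs} →
  Tile 0 P ls → Tile 0 Q rs → 
  vs ↭ map pos rs ++ map (λ x → pos (N + (P + Q)) ℤ.- pos x) ls →
  cvs ↭ map pos (iv 0 (suc N)) → 
  vs ++ map (λ z → pos Q ℤ.+ z) cvs ↭ map pos (iv 0 (suc (N + (P + Q))))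
surround {N} P Q {ls} {rs} (tile lp) (tile rp) vp cp =
  ↭-trans (++⁺ (↭-trans vp (++⁺ (map⁺ pos rp) (↭-trans (map⁺ _ lp)
              (↭-trans (↭-reflexive (cong (λ z → map (λ x → pos z ℤ.- pos x) (iv 0 P)) n-eq))
                       (reflect-iv (N + Q) P)))))
            (↭-trans (map⁺ _ cp) (↭-reflexive (trans (sym (map-∘ (iv 0 (suc N))))
              (trans (map-∘ (iv 0 (suc N))) (cong (map pos) (iv-shift Q 0 (suc N))))))))
    (↭-trans (Perm.solve 3 (λ a b c → (a ⊕ b) ⊕ c ⊜ b ⊕ (c ⊕ a)) ↭-refl
                (map pos (iv 0 Q)) (map pos (iv (suc (N + Q)) P)) (map pos (iv (Q + 0) (suc N))))
       (↭-trans (↭-reflexive (sym (trans (map-++ pos (iv (suc (N + Q)) P) _)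
              (cong (map pos (iv (suc (N + Q)) P) ++_) (map-++ pos (iv (Q + 0) (suc N)) _)))))
         (map⁺ pos (untile (retile
           ((tile ↭-refl then tile {Q + 0} {suc N} ↭-refl by refl) then tile {suc (N + Q)} {P} ↭-refl by tile-eq)
           ↭-refl len-eq)))))
  where
  n-eq : N + (P + Q) ≡ N + Q + P
  n-eq = solve (N ∷ P ∷ Q ∷ [])
  tile-eq : suc (N + Q) ≡ suc N + Q + 0
  tile-eq = solve (N ∷ Q ∷ [])
  len-eq : P + (suc N + Q) ≡ suc (N + (P + Q))
  len-eq = solve (N ∷ P ∷ Q ∷ [])

-- Common to even and odd layers, hence `P` and `Q` may differ and the new edges need not join the
-- two sides. `pd` includes the edge into the core; quantifying over `vs` keeps it independent of
-- the rest of the core's path.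
layer : ∀ {a N J Ls L} P Q {ls rs} {j oc t pd} → Core a N J Ls →
  map length oc ≡ L → Tile 0 P ls → Tile 0 Q rs →
  concat oc ++ pos j ∷ t ↭ map pos rs ++ map (λ x → pos (N + (P + Q)) ℤ.- pos x) ls →
  (∀ vs → pathDists (pos j ∷ t ++ pos (Q + J) ∷ vs) ≡ pd ++ pathDists (pos (Q + J) ∷ vs)) →
  concatMap cycleDists oc ++ pd ↭ iv (suc N) (P + Q) →
  Core a (N + (P + Q)) j (L ++ Ls)
layer {a} {N} {J} P Q {j = j} {oc} {t} {pd} c lens′ lt rt vp pd-eq dp = record
  { cycles = oc ++ map (map f) cycles
  ; lens   = ↭-trans (↭-reflexive (map-++ length oc _))
               (++⁺ (↭-reflexive lens′) (↭-trans (↭-reflexive (lens-map cycles)) lens))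
  ; twos   = Vec.map f₂ twos
  ; tail   = t ++ map f path
  ; verts  = ↭-trans (↭-reflexive (cong (_++ twoVerts (Vec.map f₂ twos) ++ (pos j ∷ t) ++ map f path)
                                        (sym (concat-++ oc (map (map f) cycles)))))
             (↭-trans (Perm.solve 5 (λ v w x y z → (v ⊕ w) ⊕ x ⊕ y ⊕ z ⊜ (v ⊕ y) ⊕ (w ⊕ x ⊕ z)) ↭-refl
                         (concat oc) (concat (map (map f) cycles)) (twoVerts (Vec.map f₂ twos))
                         (pos j ∷ t) (map f path))
             (↭-trans (++⁺ˡ (concat oc ++ pos j ∷ t) (↭-reflexive (verts-map cycles twos path)))
                      (surround P Q lt rt vp verts)))
  ; dists  = ↭-trans (↭-reflexive (cong₂ (λ x y → x ++ twoDists (Vec.map f₂ twos) ++ y)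
                                     (concatMap-++ cycleDists oc _) (pd-eq (map f tail))))
             (↭-trans (Perm.solve 5 (λ v w x y z → (v ⊕ w) ⊕ x ⊕ y ⊕ z ⊜ (v ⊕ y) ⊕ (w ⊕ x ⊕ z)) ↭-refl
                         (concatMap cycleDists oc) (concatMap cycleDists (map (map f) cycles))
                         (twoDists (Vec.map f₂ twos)) pd (pathDists (map f path)))
             (↭-trans (++⁺ dp (↭-trans (↭-reflexive (dists-map cycles twos path)) dists))
                      (↭-trans (differences-+ a N (P + Q) large)
                               (↭-reflexive (cong (differences a) (+-comm (P + Q) N))))))
  ; large  = ≤-trans large (m≤m+n N _)
  }
  where
  open Core c
  f : ℤ → ℤ
  f x = pos Q ℤ.+ x
  open Isometry f (shift-iso (pos Q))

-- The left end of the path is joined to the core's vertex `e`, which is shifted to `u + e`. This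
-- edge has the free offset, and the outer end is again labeled `e`.
attach : ∀ {a N e s L Ls} → Core a N e Ls → Alpha s e L → Core a (N + (suc (s + e) + suc (s + e))) e (L ++ Ls)
-- Without cycles in the layer, all new differences lie on the path. This is what yields the claim
-- about the differences of the path in the theorem.
attach-pathDists : ∀ {a N e s Ls} (c : Core a N e Ls) (A : Alpha s e []) →
  Σ (List ℕ) λ ds → pathDists (Core.path (attach c A)) ↭ iv (suc N) (suc (s + e) + suc (s + e)) ++ ds

module Attach {a N e s L Ls} (c : Core a N e Ls) (A : Alpha s e L) where
  open Alpha A
  n = N + (u + u)

  pd-eq : ∀ vs → pathDists (lab n path ++ pos (u + e) ∷ vs) ≡
    (map (offDist n) (offs path) ++ offDist n (e + (u + s)) ∷ []) ++ pathDists (pos (u + e) ∷ vs)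
  pd-eq vs = trans (lab-dists n path (pos (u + e)) vs)
    (trans (cong (λ d → map (offDist n) (offs path) ++ d ∷ _)
              (trans (dist-left-right n s (u + e)) (cong (offDist n) (port-eq s e))))
           (sym (++-assoc (map (offDist n) (offs path)) _ _)))
    where
    port-eq : ∀ s e → suc (s + e) + e + s ≡ e + (suc (s + e) + s)
    port-eq = solve-∀

  dists↭ : concatMap cycleDists (map (labᶜ n) cs) ++ map (offDist n) (offs path) ++ offDist n (e + (u + s)) ∷ [] ↭
           iv (suc N) (u + u)
  dists↭ = ↭-trans (++⁺ (↭-reflexive (labᶜ-dists n cs)) (++-comm (map (offDist n) (offs path)) _))
    (↭-trans (↭-reflexive (sym (map-++ (offDist n) (concatMap coffs cs) _)))
             (↭-trans (map⁺ (offDist n) (untile offs↭)) (reflect-offs N (u + u))))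

attach {N = N} {L = L} c A = layer u u c (trans (labᶜ-lens n cs) lens) left↭ right↭
    (↭-trans (++⁺ (labᶜ-verts n cs) (lab-verts n path))
      (↭-trans (Perm.solve 4 (λ a b c d → (a ⊕ b) ⊕ (c ⊕ d) ⊜ (a ⊕ c) ⊕ (b ⊕ d)) ↭-refl
                 (map pos (concatMap cright cs)) (map g (concatMap cleft cs)) (map pos (rights path)) (map g (lefts path)))
               (↭-reflexive (sym (cong₂ _++_ (map-++ pos (concatMap cright cs) _) (map-++ g (concatMap cleft cs) _))))))
    pd-eq dists↭
  where
  open Alpha A
  open Attach c A
  g : ℕ → ℤ
  g x = pos n ℤ.- pos x

attach-pathDists c A = _ , ↭-trans (↭-reflexive (pd-eq _)) (++⁺ʳ _ (↭-trans (lemma cs lens) dists↭))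
  where
  open Alpha A
  open Attach c A
  lemma : ∀ cs → map clen cs ≡ [] → ∀ {xs} → xs ↭ concatMap cycleDists (map (labᶜ n) cs) ++ xs
  lemma []       _  = ↭-refl
  lemma (_ ∷ _) ()

-- Inserting an odd cycle

noCycles : ∀ {s e} (A : Alpha s e []) → Alpha.cs A ≡ []
noCycles A with Alpha.cs A | Alpha.lens A
... | []    | _ = refl

path-lefts : ∀ {s e} (A : Alpha s e []) → Tile 0 (suc (s + e)) (lefts (Alpha.path A))
path-lefts A = subst (λ cs → Tile 0 _ (concatMap cleft cs ++ _)) (noCycles A) (Alpha.left↭ A)

path-rights : ∀ {s e} (A : Alpha s e []) → Tile 0 (suc (s + e)) (rights (Alpha.path A))
path-rights A = subst (λ cs → Tile 0 _ (concatMap cright cs ++ _)) (noCycles A) (Alpha.right↭ A)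

path-offs : ∀ {s e} (A : Alpha s e []) →
  Tile 0 (suc (s + e) + suc (s + e)) (e + (suc (s + e) + s) ∷ offs (Alpha.path A))
path-offs A = subst (λ cs → Tile 0 _ (concatMap coffs cs ++ _)) (noCycles A) (Alpha.offs↭ A)

iv-tile : ∀ a n → Tile a n (iv a n)
iv-tile a n = tile ↭-refl

-- The odd cycle has length 2 (g + 1) + 1.  Its strand has the depths u, …, u + g on both sides, and x
-- (on the left) closes it.  The path leaves out these vertices and the right vertex v, which joins
-- its end at the depth g + 1 to the core.
oddPath : ∀ b g r →
  let u = suc (suc g + b); v = suc (b + g + (u + suc g)); x = suc (b + g) + suc v in
  Z (suc g) (r + x)
oddPath b g r =
  let u = suc (suc g + b); v = suc (b + g + (u + suc g)); x = suc (b + g) + suc v in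
  ext r ((Alpha.path (pad (suc g) b) ⧺ run (u + suc g) (u + suc g) (b + g)) ⧺ run v (suc v) (suc (b + g))) (suc x)

oddPath-lefts : ∀ b g r →
  let u = suc (suc g + b); v = suc (b + g + (u + suc g)); x = suc (b + g) + suc v in
  Tile 0 (suc (suc (r + x))) (suc (r + x) ∷ x ∷ lefts (run u u g) ++ lefts (oddPath b g r))
oddPath-lefts b g r =
  let u = suc (suc g + b); v = suc (b + g + (u + suc g)); x = suc (b + g) + suc v in
  retile
  ((((((path-lefts (pad (suc g) b)
    then run-lefts u u g by solve (b ∷ g ∷ r ∷ []))
    then run-lefts (u + suc g) (u + suc g) (b + g) by solve (b ∷ g ∷ r ∷ []))
    then run-lefts v (suc v) (suc (b + g)) by solve (b ∷ g ∷ r ∷ []))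
    then point x by solve (b ∷ g ∷ r ∷ []))
    then iv-tile (suc x) r by solve (b ∷ g ∷ r ∷ []))
    then point (suc (r + x)) by solve (b ∷ g ∷ r ∷ []))
  (↭-trans (↭-reflexive (cong (λ l → suc (r + x) ∷ x ∷ lefts (run u u g) ++ l)
      (trans (lefts-ext r _ (suc x)) (cong (iv (suc x) r ++_)
        (trans (lefts-⧺ _ (run v (suc v) (suc (b + g)))) (cong (lefts (run v (suc v) (suc (b + g))) ++_)
          (lefts-⧺ (Alpha.path (pad (suc g) b)) (run (u + suc g) (u + suc g) (b + g)))))))))
    (Perm.solve 7 (λ p x s e r₂ r₁ z → p ⊕ x ⊕ s ⊕ e ⊕ r₂ ⊕ r₁ ⊕ z ⊜ p ⊕ e ⊕ x ⊕ r₂ ⊕ r₁ ⊕ s ⊕ z) ↭-refl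
      (suc (r + x) ∷ []) (x ∷ []) (lefts (run u u g)) (iv (suc x) r) (lefts (run v (suc v) (suc (b + g))))
      (lefts (run (u + suc g) (u + suc g) (b + g))) (lefts (Alpha.path (pad (suc g) b)))))
  (solve (b ∷ g ∷ r ∷ []))

oddPath-rights : ∀ b g r →
  let u = suc (suc g + b); v = suc (b + g + (u + suc g)); x = suc (b + g) + suc v in
  Tile 0 (suc (r + x)) (v ∷ rights (run u u g) ++ rights (oddPath b g r))
oddPath-rights b g r =
  let u = suc (suc g + b); v = suc (b + g + (u + suc g)); x = suc (b + g) + suc v in
  retile
  (((((path-rights (pad (suc g) b)
    then run-rights u u g by solve (b ∷ g ∷ r ∷ []))
    then run-rights (u + suc g) (u + suc g) (b + g) by solve (b ∷ g ∷ r ∷ []))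
    then point v by solve (b ∷ g ∷ r ∷ []))
    then run-rights v (suc v) (suc (b + g)) by solve (b ∷ g ∷ r ∷ []))
    then iv-tile (suc x) r by solve (b ∷ g ∷ r ∷ []))
  (↭-trans (↭-reflexive (cong (λ l → v ∷ rights (run u u g) ++ l)
      (trans (rights-ext r _ (suc x)) (cong (iv (suc x) r ++_)
        (trans (rights-⧺ _ (run v (suc v) (suc (b + g)))) (cong (rights (run v (suc v) (suc (b + g))) ++_)
          (rights-⧺ (Alpha.path (pad (suc g) b)) (run (u + suc g) (u + suc g) (b + g)))))))))
    (Perm.solve 6 (λ v s e r₂ r₁ z → v ⊕ s ⊕ e ⊕ r₂ ⊕ r₁ ⊕ z ⊜ e ⊕ r₂ ⊕ v ⊕ r₁ ⊕ s ⊕ z) ↭-refl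
      (v ∷ []) (rights (run u u g)) (iv (suc x) r) (rights (run v (suc v) (suc (b + g))))
      (rights (run (u + suc g) (u + suc g) (b + g))) (rights (Alpha.path (pad (suc g) b)))))
  (solve (b ∷ g ∷ r ∷ []))

-- Single edges plug the gaps between consecutive runs. `v + suc g`, from the path to `v`, lies
-- between the strand and the next run. `g + u + x`, from the strand to `x`, and `x + x`, reserved
-- for the edge from `v` into the core, lie before and after the run that starts at `v`.
oddPath-offs : ∀ b g r →
  let u = suc (suc g + b); v = suc (b + g + (u + suc g)); x = suc (b + g) + suc v in
  Tile 0 (suc (r + x) + (r + x))
    (g + u + x ∷ offs (run u u g) ++ offs (oddPath b g r) ++ v + suc g ∷ x + x ∷ [])
oddPath-offs b g r =
  let u = suc (suc g + b); v = suc (b + g + (u + suc g)); x = suc (b + g) + suc v in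
  retile
  ((((((((path-offs (pad (suc g) b)
    then run-offs u u g by solve (b ∷ g ∷ r ∷ []))
    then point (v + suc g) by solve (b ∷ g ∷ r ∷ []))
    then run-offs (u + suc g) (u + suc g) (b + g) by solve (b ∷ g ∷ r ∷ []))
    then point (b + g + (u + suc g) + v) by solve (b ∷ g ∷ r ∷ []))
    then point (g + u + x) by solve (b ∷ g ∷ r ∷ []))
    then run-offs v (suc v) (suc (b + g)) by solve (b ∷ g ∷ r ∷ []))
    then point (x + x) by solve (b ∷ g ∷ r ∷ []))
    then iv-tile (x + suc x) (r * 2) by solve (b ∷ g ∷ r ∷ []))
  (↭-trans (↭-reflexive (cong (λ l → g + u + x ∷ offs (run u u g) ++ l ++ v + suc g ∷ x + x ∷ [])
      (trans (offs-ext r _ (suc x)) (cong (iv (x + suc x) (r * 2) ++_)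
        (trans (offs-⧺ _ (run v (suc v) (suc (b + g))))
               (cong (λ l → offs (run v (suc v) (suc (b + g))) ++ b + g + (u + suc g) + v ∷ l)
          (offs-⧺ (Alpha.path (pad (suc g) b)) (run (u + suc g) (u + suc g) (b + g)))))))))
    (Perm.solve 9 (λ c s e r₂ l r₁ z f w → c ⊕ s ⊕ (e ⊕ r₂ ⊕ l ⊕ r₁ ⊕ z) ⊕ f ⊕ w ⊜
                                           e ⊕ w ⊕ r₂ ⊕ c ⊕ l ⊕ r₁ ⊕ f ⊕ s ⊕ z) ↭-refl
      (g + u + x ∷ []) (offs (run u u g)) (iv (x + suc x) (r * 2)) (offs (run v (suc v) (suc (b + g))))
      (b + g + (u + suc g) + v ∷ []) (offs (run (u + suc g) (u + suc g) (b + g)))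
      (b + (u + suc g) ∷ offs (Alpha.path (pad (suc g) b))) (v + suc g ∷ []) (x + x ∷ [])))
  (solve (b ∷ g ∷ r ∷ []))

dist-left-left : ∀ n u x d → n + u ≡ x + d → dist (pos n ℤ.- pos u , pos n ℤ.- pos x) ≡ offDist n d
dist-left-left n u x d e = cong ∣_∣ (trans (lem₁ (pos n) (pos u) (pos x) (pos d))
  (trans (cong (λ z → pos z ℤ.- pos u ℤ.- pos d) (sym e)) (lem₂ (pos n) (pos u) (pos d))))
  where
  lem₁ : ∀ n u x d → (n ℤ.- u) ℤ.- (n ℤ.- x) ≡ (x ℤ.+ d) ℤ.- u ℤ.- d
  lem₁ = solveℤ-∀
  lem₂ : ∀ n u d → (n ℤ.+ u) ℤ.- u ℤ.- d ≡ n ℤ.- d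
  lem₂ = solveℤ-∀

dist-right-inner : ∀ n v w o → n + v ≡ w + o → dist (pos v , pos w) ≡ offDist n o
dist-right-inner n v w o e = trans (cong ∣_∣ (lem₁ (pos v) (pos w) (pos o)))
  (trans (∣-i∣≡∣i∣ (pos (w + o) ℤ.- pos v ℤ.- pos o))
    (cong ∣_∣ (trans (cong (λ z → pos z ℤ.- pos v ℤ.- pos o) (sym e)) (lem₂ (pos n) (pos v) (pos o)))))
  where
  lem₁ : ∀ v w o → v ℤ.- w ≡ ℤ.- ((w ℤ.+ o) ℤ.- v ℤ.- o)
  lem₁ = solveℤ-∀
  lem₂ : ∀ n v o → (n ℤ.+ v) ℤ.- v ℤ.- o ≡ n ℤ.- o
  lem₂ = solveℤ-∀

left-label : ∀ n p q → q + p ≡ n → pos n ℤ.- pos p ≡ pos q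
left-label n p q refl = lem (pos q) (pos p)
  where
  lem : ∀ q p → (q ℤ.+ p) ℤ.- p ≡ q
  lem = solveℤ-∀

-- Two edges do not join left to right: the one from the left `x` to the left `cs`, and the one from
-- the right `v` to the core vertex `w`. `d` and `o` are fictitious offsets, chosen so that `n - d`
-- and `n - o` are the differences of these edges.
module OddLayer {cs ce s e} (S : Z cs ce) (z : Z s e) (n v x p d o w : ℕ)
                (d-eq : n + cs ≡ x + d) (o-eq : n + v ≡ w + o) where

  g : ℕ → ℤ
  g y = pos n ℤ.- pos y

  cycle : List ℤ
  cycle = g x ∷ lab n S

  stem : List ℤ
  stem = lab n z ++ pos v ∷ []

  stemOffs : List ℕ
  stemOffs = e + p ∷ offs z ++ v + s ∷ o ∷ []

  cycle-dists : cycleDists cycle ≡ map (offDist n) (ce + x ∷ offs S ++ d ∷ [])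
  cycle-dists = cong₂ _∷_ (dist-left-right n x ce)
    (trans (lab-dists n S (g x) [])
      (trans (cong (λ y → map (offDist n) (offs S) ++ y ∷ []) (dist-left-left n cs x d d-eq))
             (sym (map-++ (offDist n) (offs S) _))))

  stem-dists : ∀ vs → pathDists (g p ∷ stem ++ pos w ∷ vs) ≡ map (offDist n) stemOffs ++ pathDists (pos w ∷ vs)
  stem-dists vs = cong₂ _∷_ (dist-left-right n p e)
    (trans (cong pathDists (++-assoc (lab n z) (pos v ∷ []) (pos w ∷ vs)))
      (trans (lab-dists n z (pos v) (pos w ∷ vs))
        (trans (cong₂ (λ a b → map (offDist n) (offs z) ++ a ∷ b ∷ pathDists (pos w ∷ vs))
                      (dist-left-right n s v) (dist-right-inner n v w o o-eq))
          (trans (sym (++-assoc (map (offDist n) (offs z)) _ _))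
                 (cong (_++ pathDists (pos w ∷ vs)) (sym (map-++ (offDist n) (offs z) _)))))))

  verts : concat (cycle ∷ []) ++ g p ∷ stem ↭
          map pos (v ∷ rights S ++ rights z) ++ map g (p ∷ x ∷ lefts S ++ lefts z)
  verts = ↭-trans (++⁺ (++⁺ʳ [] (prep (g x) (lab-verts n S))) (prep (g p) (++⁺ʳ (pos v ∷ []) (lab-verts n z))))
    (↭-trans (Perm.solve 7 (λ gx rS lS gp rz lz v → ((gx ⊕ rS ⊕ lS) ⊕ Perm.id) ⊕ (gp ⊕ (rz ⊕ lz) ⊕ v) ⊜
                                                    (v ⊕ rS ⊕ rz) ⊕ (gp ⊕ gx ⊕ lS ⊕ lz)) ↭-refl
               (g x ∷ []) (map pos (rights S)) (map g (lefts S)) (g p ∷ [])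
               (map pos (rights z)) (map g (lefts z)) (pos v ∷ []))
      (↭-reflexive (sym (cong₂ (λ a b → (pos v ∷ a) ++ g p ∷ g x ∷ b)
                           (map-++ pos (rights S) _) (map-++ g (lefts S) _)))))

  verts-at : ∀ {h} → g p ≡ h → concat (cycle ∷ []) ++ h ∷ stem ↭
             map pos (v ∷ rights S ++ rights z) ++ map g (p ∷ x ∷ lefts S ++ lefts z)
  verts-at refl = verts

  stem-dists-at : ∀ {h} → g p ≡ h → ∀ vs →
    pathDists (h ∷ stem ++ pos w ∷ vs) ≡ map (offDist n) stemOffs ++ pathDists (pos w ∷ vs)
  stem-dists-at refl = stem-dists

  all-dists : ∀ xs → concatMap cycleDists (cycle ∷ []) ++ map (offDist n) xs ≡
    map (offDist n) ((ce + x ∷ offs S ++ d ∷ []) ++ xs)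
  all-dists xs = trans (cong (_++ map (offDist n) xs) (trans (++-identityʳ _) cycle-dists))
                       (sym (map-++ (offDist n) (ce + x ∷ offs S ++ d ∷ []) xs))

-- Here `x - u = N + 1`, so the left-left edge gets the last offset `p + p`. With `w` the frontier
-- shifted by `p`, the offset `x + x` of the edge into the core fixes the required frontier. The
-- path starts at the left vertex `p`, labeled `N + p + 1`; reflection turns this into `p`.
oddStep₁ : ∀ b g r {a Ls} →
  let u = suc (suc g + b); N = b + g + (u + suc g); v = suc N; x = suc (b + g) + suc v; p = suc (r + x) in
  Core a N (r + (b + (3 + (g + g)))) Ls →
  Core a (N + (suc p + p)) (N + suc p) (suc (2 * suc g) ∷ Ls)
oddStep₁ b g r c =
  let u = suc (suc g + b); N = b + g + (u + suc g); v = suc N; x = suc (b + g) + suc v; p = suc (r + x) in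
  let n = N + (suc p + p); S = run u u g; z = oddPath b g r in
  let module O = OddLayer S z n v x p (p + p) (x + x) (p + (r + (b + (3 + (g + g)))))
                   (solve (b ∷ g ∷ r ∷ [])) (solve (b ∷ g ∷ r ∷ [])) in
  let head-eq = left-label n p (N + suc p) (solve (b ∷ g ∷ r ∷ [])) in
  layer (suc p) p {oc = O.cycle ∷ []} {t = O.stem} {pd = map (offDist n) O.stemOffs} c
    (cong (λ l → suc l ∷ []) (trans (length-lab n S) (cong (2 *_) (pairs-run u u g))))
    (oddPath-lefts b g r) (oddPath-rights b g r)
    (O.verts-at head-eq) (O.stem-dists-at head-eq)
    (↭-trans (↭-reflexive (O.all-dists O.stemOffs))
      (↭-trans (map⁺ (offDist n) (untile (retile {n = suc p + p}
          ((oddPath-offs b g r then point (r + x + p) by solve (b ∷ g ∷ r ∷ []))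
             then point (p + p) by solve (b ∷ g ∷ r ∷ []))
          (Perm.solve 6 (λ c S d e z f → (c ⊕ S ⊕ d) ⊕ (e ⊕ z ⊕ f) ⊜ d ⊕ e ⊕ c ⊕ S ⊕ z ⊕ f) ↭-refl
             (g + u + x ∷ []) (offs S) (p + p ∷ []) (r + x + p ∷ []) (offs z) (v + suc g ∷ x + x ∷ []))
          (solve (b ∷ g ∷ r ∷ [])))))
        (reflect-offs N (suc p + p))))

-- One more right vertex `p` before the left vertex `p` takes the offset `p + p`. As `n` grows by
-- one, the left-left edge moves on to `suc (p + p)`.
oddStep₀ : ∀ b g r {a Ls} →
  let u = suc (suc g + b); N = b + g + (u + suc g); v = suc N; x = suc (b + g) + suc v; p = suc (r + x) in
  Core a N (r + (b + (3 + (g + g)))) Ls →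
  Core a (N + (suc p + suc p)) p (suc (2 * suc g) ∷ Ls)
oddStep₀ b g r c =
  let u = suc (suc g + b); N = b + g + (u + suc g); v = suc N; x = suc (b + g) + suc v; p = suc (r + x) in
  let n = N + (suc p + suc p); S = run u u g; z = oddPath b g r in
  let module O = OddLayer S z n v x p (suc (p + p)) (x + x) (suc p + (r + (b + (3 + (g + g)))))
                   (solve (b ∷ g ∷ r ∷ [])) (solve (b ∷ g ∷ r ∷ [])) in
  layer (suc p) (suc p) {oc = O.cycle ∷ []} {t = O.g p ∷ O.stem}
    {pd = map (offDist n) (p + p ∷ O.stemOffs)} c
    (cong (λ l → suc l ∷ []) (trans (length-lab n S) (cong (2 *_) (pairs-run u u g))))
    (oddPath-lefts b g r)
    (retile (oddPath-rights b g r then point p by solve (b ∷ g ∷ r ∷ [])) ↭-refl refl)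
    (↭-trans (shift (pos p) (concat (O.cycle ∷ [])) (O.g p ∷ O.stem)) (prep (pos p) O.verts))
    (λ vs → cong₂ _∷_ (dist-right-left n p p) (O.stem-dists vs))
    (↭-trans (↭-reflexive (O.all-dists (p + p ∷ O.stemOffs)))
      (↭-trans (map⁺ (offDist n) (untile (retile {n = suc p + suc p}
          (((oddPath-offs b g r then point (r + x + p) by solve (b ∷ g ∷ r ∷ []))
             then point (p + p) by solve (b ∷ g ∷ r ∷ []))
             then point (suc (p + p)) by solve (b ∷ g ∷ r ∷ []))
          (Perm.solve 7 (λ c S d q e z f → (c ⊕ S ⊕ d) ⊕ (q ⊕ e ⊕ z ⊕ f) ⊜ d ⊕ q ⊕ e ⊕ c ⊕ S ⊕ z ⊕ f) ↭-refl
             (g + u + x ∷ []) (offs S) (suc (p + p) ∷ []) (p + p ∷ []) (r + x + p ∷ []) (offs z)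
             (v + suc g ∷ x + x ∷ []))
          (solve (b ∷ g ∷ r ∷ [])))))
        (reflect-offs N (suc p + suc p))))

-- Farkas certificates: L ≤ R is a combination of the hypotheses and k the slack; the equation is then
-- a semiring identity.
certify : ∀ {L R a b} k → L ≤ R → a + R + k ≡ b + L → a ≤ b
certify {L} {R} {a} {b} k h eq =
  +-cancelʳ-≤ L a b (≤-trans (+-monoʳ-≤ a h) (≤-trans (m≤m+n (a + R) k) (≤-reflexive eq)))

-- Instances of *-monoʳ-≤ and +-mono-≤ without Preserves, which hides the terms from the ring solver.
scale : ∀ k {m n} → m ≤ n → k * m ≤ k * n
scale k = *-monoʳ-≤ k

plus : ∀ {k l m n} → k ≤ l → m ≤ n → k + m ≤ l + n
plus = +-mono-≤

castC : ∀ {a N N' j Ls} → N ≡ N' → Core a N j Ls → Core a N' j Ls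
castC refl c = c

size : ∀ c s → c + (suc (s + 0) + suc (s + 0)) ≡ c + (suc s + suc s)
size = solve-∀

single : Core 0 0 0 []
single = record { cycles = [] ; lens = ↭-refl ; twos = Vec.[] ; tail = []
                ; verts = ↭-refl ; dists = ↭-refl ; large = z≤n }

edge : Core 0 1 0 []
edge = record { cycles = [] ; lens = ↭-refl ; twos = Vec.[] ; tail = pos 1 ∷ []
              ; verts = swap _ _ ↭-refl ; dists = ↭-refl ; large = z≤n }

zigzagCore : ∀ N → Core 0 N 0 []
zigzagCore N with halve N
... | zero  , inj₁ refl = single
... | suc s , inj₁ refl = castC (size 0 s) (attach single (pad s 0))
... | zero  , inj₂ refl = edge
... | suc s , inj₂ refl = castC (size 1 s) (attach edge (pad s 0))

-- Attaching preserves the parity of the number of edges, so a start of each parity is provided: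
-- this one and `twoCore₆`.
twoCore₃ : Core 1 3 1 []
twoCore₃ = record
  { cycles = [] ; lens = ↭-refl ; twos = (pos 0 , pos 3) Vec.∷ Vec.[] ; tail = pos 2 ∷ []
  ; verts = Perm.solve 4 (λ a b c d → a ⊕ d ⊕ b ⊕ c ⊜ d ⊕ c ⊕ b ⊕ a) ↭-refl
              (pos 0 ∷ []) (pos 1 ∷ []) (pos 2 ∷ []) (pos 3 ∷ [])
  ; dists = Perm.solve 2 (λ a b → b ⊕ b ⊕ a ⊜ a ⊕ b ⊕ b) ↭-refl (1 ∷ []) (3 ∷ [])
  ; large = ≤-refl }

twoCore₆ : Core 1 6 3 []
twoCore₆ = record
  { cycles = [] ; lens = ↭-refl ; twos = (pos 1 , pos 4) Vec.∷ Vec.[]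
  ; tail = pos 2 ∷ pos 6 ∷ pos 0 ∷ pos 5 ∷ []
  ; verts = Perm.solve 7 (λ a b c d e f g → b ⊕ e ⊕ d ⊕ c ⊕ g ⊕ a ⊕ f ⊜ g ⊕ f ⊕ e ⊕ d ⊕ c ⊕ b ⊕ a) ↭-refl
              (pos 0 ∷ []) (pos 1 ∷ []) (pos 2 ∷ []) (pos 3 ∷ []) (pos 4 ∷ []) (pos 5 ∷ []) (pos 6 ∷ [])
  ; dists = Perm.solve 5 (λ a b c d e → b ⊕ b ⊕ a ⊕ c ⊕ e ⊕ d ⊜ a ⊕ b ⊕ b ⊕ e ⊕ d ⊕ c) ↭-refl
              (1 ∷ []) (3 ∷ []) (4 ∷ []) (5 ∷ []) (6 ∷ [])
  ; large = m≤m+n 3 3 }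

infix 4 _≡₂_
record _≡₂_ (m n : ℕ) : Set where
  constructor congruent
  field
    i k : ℕ
    eq  : m + (i + i) ≡ n + (k + k)

≡₂-sym : ∀ {m n} → m ≡₂ n → n ≡₂ m
≡₂-sym (congruent i k e) = congruent k i (sym e)

≡₂-trans : ∀ {l m n} → l ≡₂ m → m ≡₂ n → l ≡₂ n
≡₂-trans {l} {m} {n} (congruent i k e) (congruent i' k' e') = congruent (i + i') (k + k') (+-cancelʳ-≡ m _ _
  (trans (lem l i i' m) (trans (cong₂ _+_ e e') (lem′ m k n k'))))
  where
  lem : ∀ l i i' m → l + (i + i' + (i + i')) + m ≡ l + (i + i) + (m + (i' + i'))
  lem = solve-∀
  lem′ : ∀ m k n k' → m + (k + k) + (n + (k' + k')) ≡ n + (k + k' + (k + k')) + m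
  lem′ = solve-∀

≡₂-+ : ∀ {m n} c → m ≡₂ n → m + (c + c) ≡₂ n
≡₂-+ {m} {n} c (congruent i k e) =
  congruent i (c + k) (trans (lem m c i) (trans (cong (_+ (c + c)) e) (lem′ n c k)))
  where
  lem : ∀ m c i → m + (c + c) + (i + i) ≡ m + (i + i) + (c + c)
  lem = solve-∀
  lem′ : ∀ n c k → n + (k + k) + (c + c) ≡ n + (c + k + (c + k))
  lem′ = solve-∀

odd≢even : ∀ m n → suc (m + m) ≡ n + n → ⊥
odd≢even m       zero    ()
odd≢even zero    (suc n) e with () ← trans (suc-injective e) (+-suc n n)
odd≢even (suc m) (suc n) e = odd≢even m n (suc-injective (trans (sym (+-suc (suc m) m))
  (suc-injective (trans e (cong suc (+-suc n n))))))

even-gap : ∀ {m n} → m ≡₂ n → n ≤ m → Σ ℕ λ v → m ≡ n + (v + v)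
even-gap {m} {n} (congruent i k e) h with d , refl ← m≤n⇒∃[o]m+o≡n h with halve d
... | v , inj₁ refl = v , refl
... | v , inj₂ refl = ⊥-elim (odd≢even (v + i) k (+-cancelˡ-≡ n _ _ (trans (lem n v i) e)))
  where
  lem : ∀ n v i → n + suc (v + i + (v + i)) ≡ n + suc (v + v) + (i + i)
  lem = solve-∀

parity : ∀ m t → m ≡₂ t ⊎ suc m ≡₂ t
parity m t with halve (m + t)
... | k , inj₁ e = inj₁ (congruent t k (trans (sym (+-assoc m t t)) (trans (cong (_+ t) e) (+-comm (k + k) t))))
... | k , inj₂ e = inj₂ (congruent t (suc k)
          (trans (cong suc (sym (+-assoc m t t))) (trans (cong (λ z → suc (z + t)) e) (lem k t))))
  where
  lem : ∀ k t → suc (suc (k + k) + t) ≡ t + (suc k + suc k)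
  lem = solve-∀

half-bound : ∀ g m → 3 * suc g ≤ suc g + (m + m) → suc g ≤ m
half-bound g m h = *-cancelˡ-≤ 2 (certify 0 h (lem g m))
  where
  lem : ∀ g m → 2 * suc g + (suc g + (m + m)) + 0 ≡ 2 * m + 3 * suc g
  lem = solve-∀

frontier-bound : ∀ g b j → 2 * j + suc g + 2 ≤ suc g + (suc g + b + (suc g + b)) → j ≤ b + g
frontier-bound g b j h = *-cancelˡ-≤ 2 (certify 0 h (lem g b j))
  where
  lem : ∀ g b j → 2 * j + (suc g + (suc g + b + (suc g + b))) + 0 ≡ 2 * (b + g) + (2 * j + suc g + 2)
  lem = solve-∀

-- Put `h = g + 1`. Congruence and `3h ≤ N` give `N = 3h + 2b`, the size that the construction
-- requires; the last hypothesis then says `j ≤ b + g`, and `r` is the difference. The reflected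
-- frontier `N - j` is the one prescribed for the edge into the core.
oddStep : ∀ {a N j Ls} g → Core a N j Ls → N ≡₂ suc g → 3 * suc g ≤ N → 2 * j + suc g + 2 ≤ N →
  Σ ℕ λ p → p + j + suc g ≡ 2 * N + 2 ×
    Core a (suc (2 * p + N)) p (suc (2 * suc g) ∷ Ls) × Core a (suc (suc (2 * p + N))) p (suc (2 * suc g) ∷ Ls)
oddStep {a} {N} {j} {Ls} g c N≡₂ 3h≤N h
  with m , refl ← even-gap N≡₂ (≤-trans (m≤m+n (suc g) _) 3h≤N)
  with b , refl ← m≤n⇒∃[o]m+o≡n {suc g} {m} (half-bound g m 3h≤N)
  with r , eq ← m≤n⇒∃[o]m+o≡n {j} {b + g} (frontier-bound g b j h) =
  p , trans (p-eq₁ b g r j) (trans (cong (λ z → z + (3 * b + 5 * g + 8)) eq) (p-eq₂ b g)) ,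
  castC (N-eq₁ b g r) (flip p (J-eq₁ b g r) (oddStep₁ b g r c′)) ,
  castC (N-eq₀ b g r) (oddStep₀ b g r c′)
  where
  p = let u = suc (suc g + b); v = suc (b + g + (u + suc g)); x = suc (b + g) + suc v in suc (r + x)
  N′ = let u = suc (suc g + b) in b + g + (u + suc g)
  c′ : Core a N′ (r + (b + (3 + (g + g)))) Ls
  c′ = castC (c-eq b g) (flip (r + (b + (3 + (g + g))))
       (trans (f-eq₁ b g r j) (trans (cong (_+ (b + (3 + (g + g)))) eq) (f-eq₂ b g))) c)
    where
    c-eq : ∀ b g → suc g + (suc g + b + (suc g + b)) ≡ b + g + (suc (suc g + b) + suc g)
    c-eq = solve-∀
    f-eq₁ : ∀ b g r j → r + (b + (3 + (g + g))) + j ≡ j + r + (b + (3 + (g + g)))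
    f-eq₁ = solve-∀
    f-eq₂ : ∀ b g → b + g + (b + (3 + (g + g))) ≡ suc g + (suc g + b + (suc g + b))
    f-eq₂ = solve-∀
  p-eq₁ : ∀ b g r j → let u = suc (suc g + b); v = suc (b + g + (u + suc g)); x = suc (b + g) + suc v in
    suc (r + x) + j + suc g ≡ j + r + (3 * b + 5 * g + 8)
  p-eq₁ = solve-∀
  p-eq₂ : ∀ b g → b + g + (3 * b + 5 * g + 8) ≡ 2 * (suc g + (suc g + b + (suc g + b))) + 2
  p-eq₂ = solve-∀
  J-eq₁ : ∀ b g r →
    let u = suc (suc g + b); N = b + g + (u + suc g); x = suc (b + g) + suc (suc N); p = suc (r + x) in
    p + (N + suc p) ≡ N + (suc p + p)
  J-eq₁ = solve-∀
  N-eq₁ : ∀ b g r →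
    let u = suc (suc g + b); N = b + g + (u + suc g); x = suc (b + g) + suc (suc N); p = suc (r + x) in
    N + (suc p + p) ≡ suc (2 * p + (suc g + (suc g + b + (suc g + b))))
  N-eq₁ = solve-∀
  N-eq₀ : ∀ b g r →
    let u = suc (suc g + b); N = b + g + (u + suc g); x = suc (b + g) + suc (suc N); p = suc (r + x) in
    N + (suc p + suc p) ≡ suc (suc (2 * p + (suc g + (suc g + b + (suc g + b)))))
  N-eq₀ = solve-∀

oddLength : ℕ → ℕ
oddLength g = suc (2 * suc g)

-- step-room and triple make the next odd step possible (for cycles of length at most 2H + 1); the other
-- two constraints keep the number of edges within the bound B.
record Balanced (H B N j : ℕ) : Set where
  field
    step-room : 2 * j + H + 2 ≤ N
    triple    : 3 * H ≤ N
    N-bound   : N ≤ 2 * j + B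
    j-bound   : j ≤ suc B

-- `t` stands for a parity class only: the next odd cycle, or finally ε, dictates the parity of `N`.
Family : ℕ → List ℕ → (ℕ → ℕ → Set) → Set
Family a Ls P = ∀ t → Σ ℕ λ N → Σ ℕ λ j → Core a N j Ls × N ≡₂ t × P N j

-- `B` bounds the new core. The new room condition `2p + H + 2 ≤ 2p + N + 1` involves only the old
-- `N`, and follows from `3H ≤ N` since `H` is positive.
advance : ∀ {a N j Ls H B} g → Core a N j Ls → N ≡₂ suc g → suc g ≤ H → 3 * H ≤ N → 2 * j + H + 2 ≤ N →
  N + 2 ≤ B → 2 * N + 2 ≤ j + suc g + B + 1 → Family a (oddLength g ∷ Ls) (Balanced H B)
advance {N = N} {j} {H = H} {B} g c N≡₂ g<H 3H≤N room N≤B p≤B t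
  with oddStep g c N≡₂ (≤-trans (scale 3 g<H) 3H≤N)
                       (≤-trans (+-monoˡ-≤ 2 (+-monoʳ-≤ (2 * j) g<H)) room)
... | p , eq , c₁ , c₀ = select (parity (suc (2 * p + N)) t)
  where
  room′ : 2 * p + H + 2 ≤ suc (2 * p + N)
  room′ = certify (H + g) (plus 3H≤N g<H) (solve (p ∷ H ∷ N ∷ g ∷ []))
  triple′ : 3 * H ≤ suc (2 * p + N)
  triple′ = ≤-trans 3H≤N (m≤n⇒m≤1+n (m≤n+m N (2 * p)))
  bound : suc (suc (2 * p + N)) ≤ 2 * p + B
  bound = certify 0 N≤B (solve (p ∷ N ∷ B ∷ []))
  p≤ : p ≤ suc B
  p≤ = certify 0 (≤-trans (≤-reflexive eq) p≤B) (solve (p ∷ j ∷ g ∷ B ∷ []))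
  select : suc (2 * p + N) ≡₂ t ⊎ suc (suc (2 * p + N)) ≡₂ t →
    Σ ℕ λ N′ → Σ ℕ λ j′ → Core _ N′ j′ _ × N′ ≡₂ t × Balanced H B N′ j′
  select (inj₁ e) = _ , _ , c₁ , e , record
    { step-room = room′ ; triple = triple′ ; N-bound = <⇒≤ bound ; j-bound = p≤ }
  select (inj₂ e) = _ , _ , c₀ , e , record
    { step-room = m≤n⇒m≤1+n room′ ; triple = m≤n⇒m≤1+n triple′ ; N-bound = bound ; j-bound = p≤ }

insertOdd-N : ∀ {N j B} → N ≤ 2 * j + B → j ≤ suc B → 2 ≤ B → N + 2 ≤ 7 * B
insertOdd-N {N} {j} {B} h₁ h₂ h₃ =
  certify (2 * B) (plus h₁ (plus (scale 2 h₂) (scale 2 h₃))) (solve (N ∷ j ∷ B ∷ []))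

-- The new frontier is `2N + 2 - j - suc g`, at most `3j + 2B + 2` and hence at most `5B + 5`. The
-- factor 7 leaves `2B ≥ 4` for the additive constants.
insertOdd-j : ∀ {N j B} g → N ≤ 2 * j + B → j ≤ suc B → 2 ≤ B → 2 * N + 2 ≤ j + suc g + 7 * B + 1
insertOdd-j {N} {j} {B} g h₁ h₂ h₃ =
  certify (suc g) (plus (scale 2 h₁) (plus (scale 3 h₂) (scale 2 h₃)))
          (solve (N ∷ j ∷ g ∷ B ∷ []))

insertOdd : ∀ {a Ls H B} g → suc g ≤ H → 2 ≤ B → Family a Ls (Balanced H B) →
  Family a (oddLength g ∷ Ls) (Balanced H (7 * B))
insertOdd g g<H 2≤B F with F (suc g)
... | N , j , c , e , b = advance g c e g<H triple step-room
                                  (insertOdd-N N-bound j-bound 2≤B) (insertOdd-j g N-bound j-bound 2≤B)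
  where open Balanced b

insertOdds : ∀ {a Ls H B} gs → All (λ g → suc g ≤ H) gs → 2 ≤ B → Family a Ls (Balanced H B) →
  Family a (map oddLength gs ++ Ls) (Balanced H (7 ^ length gs * B))
insertOdds {a} {Ls} {H} {B} [] _ 2≤B F = subst (λ x → Family a Ls (Balanced H x)) (sym (*-identityˡ B)) F
insertOdds {a} {Ls} {H} {B} (g ∷ gs) (h All.∷ hs) 2≤B F =
  subst (λ x → Family a (oddLength g ∷ map oddLength gs ++ Ls) (Balanced H x)) (sym (*-assoc 7 (7 ^ length gs) B))
    (insertOdd g h (≤-trans 2≤B (m≤n*m B (7 ^ length gs) {{m^n≢0 7 (length gs)}})) (insertOdds gs hs 2≤B F))

-- Put `h = g + 1`. From `N = 3h`, the least size allowed, and `j = h - 2` the step yields the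
-- frontier `4h + 4`. This is where `4h + 3`, twice the cycle length plus one, comes from. For
-- `h = 1` a path with 3 edges and `j = 0` serves instead.
firstOdd : ∀ g → Family 0 (oddLength g ∷ []) (Balanced (suc g) (4 * suc g + 3))
firstOdd zero    = advance {B = 7} 0 (zigzagCore 3) (congruent 0 1 refl)
           ≤-refl ≤-refl ≤-refl (m≤m+n 5 2) (m≤m+n 8 1)
firstOdd (suc g) = advance {B = 4 * suc (suc g) + 3} (suc g) c (congruent 0 (suc (suc g)) (solve (g ∷ []))) ≤-refl ≤-refl
  (certify 2 (≤-refl {0}) (solve (g ∷ [])))
  (certify (g + 3) (≤-refl {0}) (solve (g ∷ [])))
  (≤-reflexive (solve (g ∷ [])))
  where
  size-eq : ∀ g → g + (suc (2 + g) + suc (2 + g)) ≡ 3 * suc (suc g)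
  size-eq = solve-∀
  c : Core 0 (3 * suc (suc g)) g []
  c = castC (size-eq g) (attach (flip g (+-identityʳ g) (zigzagCore g)) (pad 2 g))

-- The 2-cycle costs one factor 7, which is why `a` counts in the exponent of `ε₁`. Padding with the
-- left end `2H + 1` makes the core large enough for the `triple` condition; the two sizes have
-- opposite parity.
firstOdd₂ : ∀ H g → suc g ≤ H → Family 1 (oddLength g ∷ []) (Balanced H (7 * (4 * H + 3)))
firstOdd₂ H g g<H with parity (4 * H + 9) (suc g)
... | inj₁ e = advance {B = 7 * (4 * H + 3)} g c e g<H (certify (H + 9) (≤-refl {0}) (solve (H ∷ [])))
    (certify (3 * H + 5) (≤-refl {0}) (solve (H ∷ [])))
    (certify (24 * H + 10) (≤-refl {0}) (solve (H ∷ [])))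
    (certify (g + 4 + 20 * H) (≤-refl {0}) (solve (H ∷ g ∷ [])))
  where
  size-eq : ∀ H → 3 + (suc (suc (2 * H) + 1) + suc (suc (2 * H) + 1)) ≡ 4 * H + 9
  size-eq = solve-∀
  c : Core 1 (4 * H + 9) 1 []
  c = castC (size-eq H) (attach twoCore₃ (pad (suc (2 * H)) 1))
... | inj₂ e = advance {B = 7 * (4 * H + 3)} g c
    (subst (_≡₂ suc g) (shift-eq H) (≡₂-+ {suc (4 * H + 9)} {suc g} 3 e)) g<H
    (certify (H + 16) (≤-refl {0}) (solve (H ∷ [])))
    (certify (3 * H + 8) (≤-refl {0}) (solve (H ∷ [])))
    (certify (24 * H + 3) (≤-refl {0}) (solve (H ∷ [])))
    (certify (g + 12 * H) (scale 8 (≤-trans (s≤s z≤n) g<H)) (solve (H ∷ g ∷ [])))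
  where
  shift-eq : ∀ H → suc (4 * H + 9) + (3 + 3) ≡ 4 * H + 16
  shift-eq = solve-∀
  size-eq : ∀ H → 6 + (suc (suc (2 * H) + 3) + suc (suc (2 * H) + 3)) ≡ 4 * H + 16
  size-eq = solve-∀
  c : Core 1 (4 * H + 16) 3 []
  c = castC (size-eq H) (attach twoCore₆ (pad (suc (2 * H)) 3))

-- Bounds on the number of edges

-- The last two fields follow from `j-bound` once `7 ≤ B`. They are listed separately for the case
-- without odd cycles, where `B = 3` and the frontier may be 3.
record Bounded (B N j : ℕ) : Set where
  field
    frontier : 2 * j ≤ N
    N-bound  : N ≤ 2 * j + B
    j-bound  : j ≤ suc B
    j-bound₄ : 4 * j ≤ 5 * B
    j-bound₆ : 6 * j + 1 ≤ 7 * B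

balanced⇒bounded : ∀ {H B N j} → 7 ≤ B → Balanced H B N j → Bounded B N j
balanced⇒bounded {H} {B} {N} {j} 7≤B b = record
  { frontier = certify (H + 2) step-room (solve (j ∷ H ∷ N ∷ []))
  ; N-bound  = N-bound
  ; j-bound  = j-bound
  ; j-bound₄ = certify 3 (plus (scale 4 j-bound) 7≤B) (solve (j ∷ B ∷ []))
  ; j-bound₆ = certify 0 (plus (scale 6 j-bound) 7≤B) (solve (j ∷ B ∷ []))
  }
  where open Balanced b

weaken : ∀ {B B' N j} → B ≤ B' → Bounded B N j → Bounded B' N j
weaken {j = j} h b = record
  { frontier = frontier
  ; N-bound  = ≤-trans N-bound (+-monoʳ-≤ (2 * j) h)
  ; j-bound  = ≤-trans j-bound (s≤s h)
  ; j-bound₄ = ≤-trans j-bound₄ (scale 5 h)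
  ; j-bound₆ = ≤-trans j-bound₆ (scale 7 h)
  }
  where open Bounded b

relax : ∀ {a Ls P Q} → (∀ {N j} → P N j → Q N j) → Family a Ls P → Family a Ls Q
relax f F t with F t
... | N , j , c , e , p = N , j , c , e , f p

noOdds : ∀ a → a ≤ 1 → Family a [] (Bounded 3)
noOdds zero _ t with parity 2 t
... | inj₁ e = 2 , 0 , zigzagCore 2 , e , record
  { frontier = z≤n ; N-bound = m≤m+n 2 1 ; j-bound = z≤n ; j-bound₄ = z≤n ; j-bound₆ = m≤m+n 1 20 }
... | inj₂ e = 3 , 0 , zigzagCore 3 , e , record
  { frontier = z≤n ; N-bound = ≤-refl ; j-bound = z≤n ; j-bound₄ = z≤n ; j-bound₆ = m≤m+n 1 20 }
noOdds (suc zero) _ t with parity 3 t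
... | inj₁ e = 3 , 1 , twoCore₃ , e , record
  { frontier = m≤m+n 2 1 ; N-bound = m≤m+n 3 2 ; j-bound = m≤m+n 1 3 ; j-bound₄ = m≤m+n 4 11 ; j-bound₆ = m≤m+n 7 14 }
... | inj₂ e = 6 , 3 , twoCore₆ , ≡₂-+ {4} {t} 1 e , record
  { frontier = ≤-refl ; N-bound = m≤m+n 6 3 ; j-bound = m≤m+n 3 1 ; j-bound₄ = m≤m+n 12 3 ; j-bound₆ = m≤m+n 19 2 }
noOdds (suc (suc _)) (s≤s ())

-- With the largest odd cycle innermost, only the first step pays for its length; `Balanced` for
-- this `H` leaves room for every shorter one, at the cost of a factor 7.
largest-first : ∀ g gs → Σ ℕ λ m → Σ (List ℕ) λ rest → (g ∷ gs ↭ m ∷ rest) × All (_≤ m) rest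
largest-first g []        = g , [] , ↭-refl , All.[]
largest-first g (g' ∷ gs) with largest-first g' gs
... | m , rest , p , bs with ≤-total g m
...   | inj₁ g≤m = m , g ∷ rest , ↭-trans (prep g p) (swap g m ↭-refl) , g≤m All.∷ bs
...   | inj₂ m≤g = g , m ∷ rest , prep g p , m≤g All.∷ All.map (λ h → ≤-trans h m≤g) bs

maxL-bounds : ∀ L → All (_≤ maxL L) L
maxL-bounds []      = All.[]
maxL-bounds (x ∷ L) = m≤m⊔n x (maxL L) All.∷ All.map (λ h → ≤-trans h (m≤n⊔m x (maxL L))) (maxL-bounds L)

oddHalves : ∀ L → All (λ ℓ → Odd ℓ × 2 < ℓ) L → Σ (List ℕ) λ gs → L ≡ map oddLength gs
oddHalves [] _ = [] , refl
oddHalves (_ ∷ L) (((zero , refl) , s≤s ()) All.∷ _)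
oddHalves (_ ∷ L) (((suc g , refl) , _) All.∷ os) with oddHalves L os
... | gs , refl = g ∷ gs , cong (λ x → suc x ∷ map oddLength gs) (*-comm (suc g) 2)

odds : ∀ a gs → a ≤ 1 → Σ (List ℕ) λ Ls → Ls ↭ map oddLength gs ×
  Family a Ls (Bounded (ε₁ (map oddLength gs) a))
odds a []       a≤1 = [] , ↭-refl , relax (weaken (m≤m⊔n 3 (7 ^ (a ∸ 1) * 1))) (noOdds a a≤1)
odds a (g ∷ gs) a≤1 with largest-first g gs
... | m , rest , p , bs = map oddLength rest ++ oddLength m ∷ [] ,
  ↭-trans (++-comm (map oddLength rest) (oddLength m ∷ [])) (↭-sym (map⁺ oddLength p)) ,
  main a a≤1
  where
  L = map oddLength (g ∷ gs)
  M = 4 * suc m + 3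
  n = length rest
  bs′ : All (λ g → suc g ≤ suc m) rest
  bs′ = All.map s≤s bs
  max-bound : oddLength m ≤ maxL L
  max-bound = All.head (All-resp-↭ (map⁺ oddLength p) (maxL-bounds L))
  M≤ : M ≤ 2 * maxL L + 1
  M≤ = certify 0 (scale 2 max-bound) (lem m (maxL L))
    where
    lem : ∀ m k → 4 * suc m + 3 + 2 * k + 0 ≡ 2 * k + 1 + 2 * suc (2 * suc m)
    lem = solve-∀
  7≤M : 7 ≤ M
  7≤M = certify (4 * m) (≤-refl {0}) (lem m)
    where
    lem : ∀ m → 7 + 0 + 4 * m ≡ 4 * suc m + 3 + 0
    lem = solve-∀
  len-eq : length gs ≡ n
  len-eq = suc-injective (↭-length p)
  7^≥1 : ∀ k {x} → x ≤ 7 ^ k * x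
  7^≥1 k {x} = m≤n*m x (7 ^ k) {{m^n≢0 7 k}}
  main : ∀ a → a ≤ 1 → Family a (map oddLength rest ++ oddLength m ∷ []) (Bounded (ε₁ L a))
  main zero _ = relax (λ b → weaken below (balanced⇒bounded (≤-trans 7≤M (7^≥1 n)) b))
                      (insertOdds rest bs′ (≤-trans (m≤m+n 2 5) 7≤M) (firstOdd m))
    where
    below : 7 ^ n * M ≤ ε₁ L 0
    below = ≤-trans (≤-trans (*-monoʳ-≤ (7 ^ n) M≤)
                             (≤-reflexive (cong (λ k → 7 ^ k * (2 * maxL L + 1))
                               (sym (trans (+-identityʳ _) (trans (length-map oddLength gs) len-eq))))))
                    (m≤n⊔m 3 _)
  main (suc zero) _ = relax (λ b → weaken below (balanced⇒bounded (≤-trans (≤-trans 7≤M (7^≥1 1)) (7^≥1 n)) b))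
                      (insertOdds rest bs′ (≤-trans (≤-trans (m≤m+n 2 5) 7≤M) (7^≥1 1))
                                  (firstOdd₂ (suc m) m ≤-refl))
    where
    below : 7 ^ n * (7 * M) ≤ ε₁ L 1
    below = ≤-trans (≤-trans (*-monoʳ-≤ (7 ^ n) (scale 7 M≤))
                             (≤-reflexive (trans (lem (7 ^ n) (2 * maxL L + 1))
                               (cong (λ k → 7 ^ k * (2 * maxL L + 1))
                               (sym (trans (+-comm _ 1) (cong suc (trans (length-map oddLength gs) len-eq))))))))
                    (m≤n⊔m 3 _)
      where
      lem : ∀ a b → a * (7 * b) ≡ 7 * a * b
      lem = solve-∀
  main (suc (suc _)) (s≤s ())

-- Wrapping a path around the core gives every number of edges of the same parity from N + 2 (J + 1) on.
record Extendable (a : ℕ) (Ls : List ℕ) (e B N₀ : ℕ) : Set where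
  field
    {N J}   : ℕ
    core    : Core a N J Ls
    same    : N ≡₂ N₀
    N-bound : N ≤ 4 * e + 5 * B + 6
    J-bound : N + 2 * suc J ≤ 6 * e + 7 * B + 9

-- The even layer accepts any frontier from `U` on. If `j` is too small, the reflected frontier
-- `K = N - j` is tried; if that is too small as well, the core is padded with the frontier `j` and
-- then reflected.
insertEvens : ∀ {a Ls L e B N j q U} → Core a N j Ls → Bounded B N j → 2 ≤ B →
  (∀ d → Alpha q (U + d) L) → 2 * U ≤ e + 1 → 2 * q ≤ e + 1 → 1 ≤ e → Extendable a (L ++ Ls) e B N
insertEvens {a} {Ls} {L} {e} {B} {N} {j} {q} {U} c b 2≤B A U≤ q≤ 1≤e with ≤-total U j
... | inj₁ U≤j with d , refl ← m≤n⇒∃[o]m+o≡n U≤j = record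
  { core    = attach c (A d)
  ; same    = congruent 0 (suc (q + (U + d))) (+-identityʳ _)
  ; N-bound = bound₁ (U + d) N-bound j-bound
  ; J-bound = bound₂ (U + d) N-bound j-bound
  }
  where
  open Bounded b
  bound₁ : ∀ j → N ≤ 2 * j + B → j ≤ suc B → N + (suc (q + j) + suc (q + j)) ≤ 4 * e + 5 * B + 6
  bound₁ j h₁ h₂ = certify 2 (plus h₁ (plus (scale 4 h₂) (plus q≤ (scale 3 1≤e))))
                             (solve (N ∷ q ∷ j ∷ e ∷ B ∷ []))
  bound₂ : ∀ j → N ≤ 2 * j + B → j ≤ suc B → N + (suc (q + j) + suc (q + j)) + 2 * suc j ≤ 6 * e + 7 * B + 9
  bound₂ j h₁ h₂ = certify 3 (plus h₁ (plus (scale 6 h₂) (plus q≤ (scale 5 1≤e))))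
                             (solve (N ∷ q ∷ j ∷ e ∷ B ∷ []))
... | inj₂ j≤U with K , refl ← m≤n⇒∃[o]m+o≡n (≤-trans (m≤m+n j (j + 0)) (Bounded.frontier b)) with ≤-<-connex U K
...   | inj₁ U≤K with d , refl ← m≤n⇒∃[o]m+o≡n U≤K = record
  { core    = attach (flip (U + d) (+-comm (U + d) j) c) (A d)
  ; same    = congruent 0 (suc (q + (U + d))) (+-identityʳ _)
  ; N-bound = bound₁ (U + d) N-bound
  ; J-bound = bound₂ (U + d) N-bound
  }
  where
  open Bounded b
  bound₁ : ∀ J → j + J ≤ 2 * j + B → j + J + (suc (q + J) + suc (q + J)) ≤ 4 * e + 5 * B + 6
  bound₁ J h = certify (2 * B + 2) (plus (scale 3 h) (plus (scale 4 j≤U) (plus (scale 2 U≤) (plus q≤ 1≤e))))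
                       (solve (j ∷ J ∷ q ∷ e ∷ B ∷ U ∷ []))
  bound₂ : ∀ J → j + J ≤ 2 * j + B → j + J + (suc (q + J) + suc (q + J)) + 2 * suc J ≤ 6 * e + 7 * B + 9
  bound₂ J h = certify (2 * B + 3) (plus (scale 5 h) (plus (scale 6 j≤U) (plus (scale 3 U≤) (plus q≤ (scale 2 1≤e)))))
                       (solve (j ∷ J ∷ q ∷ e ∷ B ∷ U ∷ []))
...   | inj₂ K<U = record
  { core    = attach (flip (U + proj₁ gap) (trans (cong (_+ j) (proj₂ gap)) (J-eq j K s))
                     (attach c (pad s j))) (A (proj₁ gap))
  ; same    = congruent 0 (suc (s + j) + suc (q + (U + proj₁ gap)))
                    (same-eq (j + K) (suc (s + j)) (suc (q + (U + proj₁ gap))))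
  ; N-bound = subst (λ J → j + K + (suc (s + j) + suc (s + j)) + (suc (q + J) + suc (q + J)) ≤ 4 * e + 5 * B + 6)
                    (sym (proj₂ gap)) (bound₁ s-cases)
  ; J-bound = subst (λ J → j + K + (suc (s + j) + suc (s + j)) + (suc (q + J) + suc (q + J)) + 2 * suc J
                                        ≤ 6 * e + 7 * B + 9)
                    (sym (proj₂ gap)) (bound₂ s-cases)
  }
  where
  open Bounded b
  -- Already `s = 0` gives the reflected frontier `K + 2(j + 1)`; the truncated difference enlarges
  -- the padding only if `U` exceeds `j + K + j`.
  s = U ∸ (j + K + j)
  s-cases : s ≡ 0 ⊎ s + (j + K + j) ≡ U
  s-cases with ≤-total U (j + K + j)
  ... | inj₁ h = inj₁ (m≤n⇒m∸n≡0 h)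
  ... | inj₂ h = inj₂ (m∸n+n≡m h)
  U≤J : U ≤ K + (suc (s + j) + suc (s + j))
  U≤J = certify (s + 2) (m≤n+m∸n U (j + K + j)) (lem U K s j)
    where
    lem : ∀ U K s j → U + (j + K + j + s) + (s + 2) ≡ K + (suc (s + j) + suc (s + j)) + U
    lem = solve-∀
  gap : Σ ℕ λ d → U + d ≡ K + (suc (s + j) + suc (s + j))
  gap = m≤n⇒∃[o]m+o≡n U≤J
  J-eq : ∀ j K s → K + (suc (s + j) + suc (s + j)) + j ≡ j + K + (suc (s + j) + suc (s + j))
  J-eq = solve-∀
  same-eq : ∀ N x y → N + (x + x) + (y + y) + (0 + 0) ≡ N + (x + y + (x + y))
  same-eq = solve-∀
  j≤K : j ≤ K
  j≤K = certify 0 frontier (solve (j ∷ K ∷ []))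
  bound₁ : ∀ {s} → s ≡ 0 ⊎ s + (j + K + j) ≡ U → let J = K + (suc (s + j) + suc (s + j)) in
    j + K + (suc (s + j) + suc (s + j)) + (suc (q + J) + suc (q + J)) ≤ 4 * e + 5 * B + 6
  -- No slack here, nor in the same case of `bound₂`: the constants in `Extendable` come from this
  -- case.
  bound₁ (inj₁ refl) = certify 0 (plus (scale 6 K<U) (plus (scale 3 j≤K) (plus (scale 3 U≤) (plus q≤ j-bound₄))))
                                 (solve (j ∷ K ∷ q ∷ e ∷ B ∷ U ∷ []))
  bound₁ {s} (inj₂ h) = certify (3 * K + 5 * j + 2 * B)
    (plus (scale 6 (≤-reflexive h)) (plus (scale 3 U≤) (plus q≤ (scale 3 2≤B))))
                                (solve (j ∷ K ∷ q ∷ e ∷ B ∷ U ∷ s ∷ []))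
  bound₂ : ∀ {s} → s ≡ 0 ⊎ s + (j + K + j) ≡ U → let J = K + (suc (s + j) + suc (s + j)) in
    j + K + (suc (s + j) + suc (s + j)) + (suc (q + J) + suc (q + J)) + 2 * suc J ≤ 6 * e + 7 * B + 9
  bound₂ (inj₁ refl) = certify 0 (plus (scale 10 K<U) (plus (scale 5 j≤K) (plus (scale 5 U≤) (plus q≤ j-bound₆))))
                                 (solve (j ∷ K ∷ q ∷ e ∷ B ∷ U ∷ []))
  bound₂ {s} (inj₂ h) = certify (1 + 5 * K + 9 * j + B)
    (plus (scale 10 (≤-reflexive h)) (plus (scale 5 U≤) (plus q≤ (scale 6 2≤B))))
                                (solve (j ∷ K ∷ q ∷ e ∷ B ∷ U ∷ s ∷ []))

-- The theorem

-- The largest number with remainder 3 modulo 4 that does not exceed `maxL L + 3`; it still bounds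
-- all lengths, and it is the cost of one cycle in `evenChain`.
width : List ℕ → ℕ
width L = 3 + 4 * (maxL L / 4)

width≤ : ∀ L → width L ≤ maxL L + 3
width≤ L = ≤-trans (≤-reflexive (+-comm 3 _))
  (+-monoˡ-≤ 3 (≤-trans (≤-reflexive (*-comm 4 (maxL L / 4))) (m/n*n≤m (maxL L) 4)))

max≤width : ∀ L → maxL L ≤ width L
max≤width L = ≤-trans (≤-reflexive (m≡m%n+[m/n]*n (maxL L) 4))
  (+-mono-≤ (≤-pred (m%n<n (maxL L) 4)) (≤-reflexive (*-comm (maxL L / 4) 4)))

ε₀-bound : ∀ L → 2 * (length L * (maxL L + 3)) ≤ ε₀ L + 1
ε₀-bound L = ≤-trans (≤-reflexive (sym (*-assoc 2 (length L) (maxL L + 3))))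
  (≤-trans (m≤n+m∸n _ 1) (≤-trans (s≤s (m≤n⊔m 1 _)) (≤-reflexive (+-comm 1 _))))

ε₀-frontier : ∀ L → 2 * suc (3 * (maxL L / 4)) ≤ ε₀ L + 1
-- The shared frontier is 1 here, which needs the lower bound 1 in the definition of `ε₀`.
ε₀-frontier []       = ≤-refl
ε₀-frontier (x ∷ xs) = ≤-trans (scale 2 (≤-trans (s≤s (≤-trans (*-monoˡ-≤ k (m≤m+n 3 1)) (m≤n+m (4 * k) 2)))
    (≤-trans (width≤ (x ∷ xs)) (m≤m+n _ _)))) (ε₀-bound (x ∷ xs))
  where
  k = maxL (x ∷ xs) / 4

evensFor : ∀ L → All (λ ℓ → Even ℓ × ℓ > 2) L →
  Σ ℕ λ U → (∀ d → Alpha (suc (3 * (maxL L / 4))) (U + d) L) × 2 * U ≤ ε₀ L + 1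
evensFor L evens with evenChain (maxL L / 4) L evens (All.map (λ h → ≤-trans h (max≤width L)) (maxL-bounds L))
... | U , U≤ , A = U , A ,
  ≤-trans (scale 2 (≤-trans U≤ (*-monoʳ-≤ (length L) (width≤ L)))) (ε₀-bound L)

-- From cores to graceful labelings

concatMap-↭ : ∀ {A B : Set} (f : A → List B) {xs ys} → xs ↭ ys → concatMap f xs ↭ concatMap f ys
concatMap-↭ f _↭_.refl      = ↭-refl
concatMap-↭ f (prep x p)    = ++⁺ˡ (f x) (concatMap-↭ f p)
concatMap-↭ f (swap x y p)  = ↭-trans
  (Perm.solve 3 (λ a b c → a ⊕ b ⊕ c ⊜ b ⊕ a ⊕ c) ↭-refl (f x) (f y) _)
  (++⁺ˡ (f y) (++⁺ˡ (f x) (concatMap-↭ f p)))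
concatMap-↭ f (_↭_.trans p q)   = ↭-trans (concatMap-↭ f p) (concatMap-↭ f q)

upTo-iv : ∀ a n → map (a +_) (upTo n) ↭ iv a n
upTo-iv a zero    = ↭-refl
upTo-iv a (suc n) = ↭-trans (↭-reflexive (trans (cong (map (a +_)) (sym (upTo-∷ʳ n)))
    (map-++ (a +_) (upTo n) (n ∷ []))))
  (↭-trans (++-comm (map (a +_) (upTo n)) (a + n ∷ []))
           (↭-trans (prep (a + n) (upTo-iv a n)) (↭-reflexive (cong (_∷ iv a n) (+-comm a n)))))

I-iv : ∀ a b → I a b ↭ iv a (suc b ∸ a)
I-iv a b = upTo-iv a (suc b ∸ a)

pm-abs : ∀ x y → (x ℤ.- y) ∷ (y ℤ.- x) ∷ [] ↭ pos (dist (x , y)) ∷ ℤ.- pos (dist (x , y)) ∷ []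
pm-abs x y = ↭-trans (↭-reflexive (cong (λ w → (x ℤ.- y) ∷ w ∷ []) (lem x y))) (abs (x ℤ.- y))
  where
  lem : ∀ x y → y ℤ.- x ≡ ℤ.- (x ℤ.- y)
  lem = solveℤ-∀
  abs : ∀ z → z ∷ ℤ.- z ∷ [] ↭ pos ∣ z ∣ ∷ ℤ.- pos ∣ z ∣ ∷ []
  abs (pos n)  = ↭-refl
  abs -[1+ n ] = swap _ _ ↭-refl

Δ-dists : ∀ es → Δ es ↭ pm (map dist es)
Δ-dists []             = ↭-refl
Δ-dists ((x , y) ∷ es) = ++⁺ (pm-abs x y) (Δ-dists es)

pm-split : ∀ xs → pm xs ↭ map pos xs ++ map (λ x → ℤ.- pos x) xs
pm-split []       = ↭-refl
pm-split (x ∷ xs) = prep (pos x) (↭-trans (prep (ℤ.- pos x) (pm-split xs)) (↭-sym (shift (ℤ.- pos x) (map pos xs) _)))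

± : ℕ → List ℤ
± x = pos x ∷ ℤ.- pos x ∷ []

pm-differences : ∀ a ε → pm (differences a ε) ↭ targetΔ a ε
pm-differences zero    ε = concatMap-↭ ± (↭-sym (I-iv 1 ε))
pm-differences (suc a) ε = ↭-trans (concatMap-↭ ± {1 ∷ 3 ∷ 3 ∷ iv 4 (ε ∸ 3)}
  (++⁺ˡ (1 ∷ 3 ∷ 3 ∷ []) (↭-sym (I-iv 4 ε))))
  (↭-reflexive (concatMap-++ ± (1 ∷ 3 ∷ 3 ∷ []) (I 4 ε)))

length-concat : (cs : List (List ℤ)) → length (concat cs) ≡ sum (map length cs)
length-concat []       = refl
length-concat (c ∷ cs) = trans (length-++ c) (cong (length c +_) (length-concat cs))

length-twoVerts : ∀ {a} (ts : Vec (ℤ × ℤ) a) → length (twoVerts ts) ≡ 2 * a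
length-twoVerts Vec.[]             = refl
length-twoVerts {suc a} (_ Vec.∷ ts) = trans (cong (2 +_) (length-twoVerts ts)) (sym (*-suc 2 a))

length-iv : ∀ a n → length (iv a n) ≡ n
length-iv a zero    = refl
length-iv a (suc n) = cong suc (length-iv a n)

module ToLabeling {a ε J Ls} (L₀ L₁ : List ℕ) (c : Core a ε J Ls) (Ls↭ : Ls ↭ L₀ ++ L₁) where
  open Core c

  sorted : Σ (List (List ℤ)) λ cs → L₀ ++ L₁ ≡ map length cs × cycles ↭ cs
  sorted = ↭-map-inv length (↭-trans lens Ls↭)

  cs : List (List ℤ)
  cs = proj₁ sorted

  m : ℕ
  m = ε ∸ sum (L₀ ++ L₁) ∸ 2 * a

  -- A core does not record the length of its path. Counting vertices recovers it, as a cycle has as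
  -- many vertices as edges and the path has one more.
  size-eq : sum (L₀ ++ L₁) + (2 * a + length tail) ≡ ε
  size-eq = suc-injective (trans (sym (trans (cong (sum (L₀ ++ L₁) +_) (+-suc (2 * a) (length tail)))
                                                   (+-suc (sum (L₀ ++ L₁)) _)))
    (trans (sym count) (trans (↭-length verts) (trans (length-map pos (iv 0 (suc ε))) (length-iv 0 (suc ε))))))
    where
    count : length (concat cycles ++ twoVerts twos ++ path) ≡ sum (L₀ ++ L₁) + (2 * a + suc (length tail))
    count = trans (length-++ (concat cycles)) (cong₂ _+_
      (trans (length-concat cycles) (sum-↭ (↭-trans lens Ls↭)))
      (trans (length-++ (twoVerts twos)) (cong (_+ suc (length tail)) (length-twoVerts twos))))

  m-eq : length tail ≡ m
  m-eq = sym (trans (cong (λ z → z ∸ sum (L₀ ++ L₁) ∸ 2 * a) (sym size-eq))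
    (trans (cong (_∸ 2 * a) (m+n∸m≡n (sum (L₀ ++ L₁)) _)) (m+n∸m≡n (2 * a) (length tail))))

  numEdges-eq : numEdges L₀ L₁ a m ≡ ε
  numEdges-eq = trans (cong (sum (L₀ ++ L₁) + 2 * a +_) (sym m-eq))
    (trans (+-assoc (sum (L₀ ++ L₁)) (2 * a) (length tail)) size-eq)

  labeling : Labeling L₀ L₁ a m
  labeling = record
    { cycles    = cs
    ; cycleLens = sym (proj₁ (proj₂ sorted))
    ; twos      = twos
    ; path      = path
    ; pathLen   = cong suc m-eq
    }

  vertices↭ : Labeling.vertices labeling ↭ map pos (iv 0 (suc ε))
  vertices↭ = ↭-trans (++⁺ (↭-sym (concat↭ (proj₂ (proj₂ sorted))))
                           (↭-reflexive (cong (_++ path) (concatMap-cong (λ _ → refl) (toList twos))))) verts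
    where
    concat↭ : ∀ {xs ys : List (List ℤ)} → xs ↭ ys → concat xs ↭ concat ys
    concat↭ {xs} {ys} p = ↭-trans (↭-reflexive (cong concat (sym (map-id xs))))
      (↭-trans (concatMap-↭ (λ x → x) p) (↭-reflexive (cong concat (map-id ys))))

  dists↭ : map dist (Labeling.edges labeling) ↭ differences a ε
  dists↭ = ↭-trans (↭-reflexive (trans (map-++ dist (concatMap cycleEdges cs) _)
      (cong₂ _++_ (map-concatMap dist cycleEdges cs) (map-++ dist (concatMap twoCycleEdges (toList twos)) _))))
    (↭-trans (++⁺ʳ _ (↭-sym (concatMap-↭ cycleDists (proj₂ (proj₂ sorted))))) dists)

  graceful : IsGraceful labeling
  graceful = unique ,
    ↭-trans vertices↭ (map⁺ pos (↭-sym (↭-trans (I-iv 0 _)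
      (↭-reflexive (cong (λ z → iv 0 (suc z)) numEdges-eq))))) ,
    ↭-trans (Δ-dists (Labeling.edges labeling)) (↭-trans (concatMap-↭ ± dists↭)
      (↭-trans (pm-differences a ε) (↭-reflexive (cong (targetΔ a) (sym numEdges-eq)))))
    where
    unique : Unique (Labeling.vertices labeling)
    unique = Unique-resp-↭ (↭⇒↭ₛ (↭-sym (↭-trans vertices↭ (map⁺ pos (↭-sym (upTo-iv 0 (suc ε)))))))
                           (Unique-map⁺ +-injective (Unique-map⁺ (λ e → e) (upTo⁺ (suc ε))))

tail-interval : ∀ N n lo → suc N ≤ lo → lo ≤ suc (N + n) → Σ ℕ λ d →
  iv (suc N) n ≡ iv lo (suc (N + n) ∸ lo) ++ iv (suc N) d
tail-interval N n lo h₁ h₂ with d , refl ← m≤n⇒∃[o]m+o≡n h₁ with k , e ← m≤n⇒∃[o]m+o≡n h₂ =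
  d , trans (cong (iv (suc N)) n-eq) (trans (iv-++ (suc N) d k)
    (cong₂ (λ x y → iv x y ++ iv (suc N) d) (+-comm d (suc N))
           (sym (trans (cong (_∸ (suc N + d)) (sym e)) (m+n∸m≡n (suc N + d) k)))))
  where
  n-eq : n ≡ k + d
  n-eq = +-cancelˡ-≡ (suc N) _ _ (trans (sym e) (lem N d k))
    where
    lem : ∀ N d k → suc N + d + k ≡ suc N + (k + d)
    lem = solve-∀

-- The outermost layer is a bare path, so all differences above `N` belong to the path, and `lo`
-- lies above `N`.
extension : ∀ {a N J Ls ε} L₀ L₁ lo v → Core a N J Ls → Ls ↭ L₀ ++ L₁ →
  ε ≡ N + (suc (v + J) + suc (v + J)) → suc N ≤ lo → lo ≤ suc ε →
  Σ (Labeling L₀ L₁ a (ε ∸ sum (L₀ ++ L₁) ∸ 2 * a)) λ Γ →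
    IsGraceful Γ × map pos (I lo ε) ⊆ₘ Labeling.ΔpΓ Γ
extension {N = N} {J} L₀ L₁ lo v c Ls↭ refl h₁ h₂ =
  T.labeling , T.graceful , map pos (low ++ ds) ++ negatives ,
  ↭-trans (Δ-dists (pathEdges (Core.path final)))
    (↭-trans (pm-split (pathDists (Core.path final)))
      (↭-trans (++⁺ʳ negatives (map⁺ pos (↭-trans (proj₂ path-split)
                 (↭-reflexive (trans (cong (_++ ds) (proj₂ interval)) (++-assoc high low ds))))))
        (↭-trans (↭-reflexive (trans (cong (_++ negatives) (map-++ pos high (low ++ ds)))
                                       (++-assoc (map pos high) (map pos (low ++ ds)) negatives)))
                 (++⁺ʳ (map pos (low ++ ds) ++ negatives) (map⁺ pos (↭-sym (I-iv lo (N + n))))))))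
  where
  n = suc (v + J) + suc (v + J)
  final = attach c (pad v J)
  module T = ToLabeling L₀ L₁ final Ls↭
  path-split = attach-pathDists c (pad v J)
  ds = proj₁ path-split
  interval = tail-interval N n lo h₁ h₂
  negatives = map (λ x → ℤ.- pos x) (pathDists (Core.path final))
  high = iv lo (suc (N + n) ∸ lo)
  low = iv (suc N) (proj₁ interval)

twice-suc : ∀ N J → N + (suc J + suc J) ≡ N + 2 * suc J
twice-suc = solve-∀

pad-size : ∀ N J v → N + (suc J + suc J) + (v + v) ≡ N + (suc (v + J) + suc (v + J))
pad-size = solve-∀

frontier-room : ∀ {N J ε M} → N ≡₂ ε → N + 2 * suc J ≤ M → M ≤ ε → Σ ℕ λ v → ε ≡ N + (suc (v + J) + suc (v + J))
frontier-room {N} {J} {ε} N≡₂ε h₁ h₂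
  with v , e ← even-gap (≡₂-sym (≡₂-+ (suc J) N≡₂ε)) (≤-trans (≤-reflexive (twice-suc N J)) (≤-trans h₁ h₂)) =
  v , trans e (pad-size N J v)

finish : ∀ {a Ls e B N₀ ε} L₀ L₁ → Extendable a (L₀ ++ Ls) e B N₀ → Ls ↭ L₁ → N₀ ≡₂ ε → 6 * e + 7 * B + 9 ≤ ε →
  Σ (Labeling L₀ L₁ a (ε ∸ sum (L₀ ++ L₁) ∸ 2 * a)) λ Γ →
    IsGraceful Γ × map pos (I (4 * e + 5 * B + 7) ε) ⊆ₘ Labeling.ΔpΓ Γ
finish {e = e} {B} L₀ L₁ E Ls↭ N₀≡₂ε h = extension L₀ L₁ (4 * e + 5 * B + 7) (proj₁ room) E.core
  (++⁺ˡ L₀ Ls↭) (proj₂ room)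
  (≤-trans (s≤s E.N-bound) (≤-reflexive (sym (+-suc (4 * e + 5 * B) 6))))
  (m≤n⇒m≤1+n (≤-trans (+-mono-≤ (+-mono-≤ (*-monoˡ-≤ e (m≤m+n 4 2)) (*-monoˡ-≤ B (m≤m+n 5 2))) (m≤m+n 7 2)) h))
  where
  module E = Extendable E
  room = frontier-room (≡₂-trans E.same N₀≡₂ε) E.J-bound h

theorem-halves : ∀ L₀ gs a → All (λ ℓ → Even ℓ × ℓ > 2) L₀ → a ≤ 1 →
  ∀ ε → 6 * ε₀ L₀ + 7 * ε₁ (map oddLength gs) a + 9 ≤ ε →
  Σ (Labeling L₀ (map oddLength gs) a (ε ∸ sum (L₀ ++ map oddLength gs) ∸ 2 * a)) λ Γ →
    IsGraceful Γ × map pos (I (4 * ε₀ L₀ + 5 * ε₁ (map oddLength gs) a + 7) ε) ⊆ₘ Labeling.ΔpΓ Γ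
theorem-halves L₀ gs a even a≤1 ε =
  let Ls , Ls↭ , family = odds a gs a≤1
      -- The parity is chosen now, because all later layers add an even number of edges.
      N₀ , j , c , N₀≡₂ε , bounded = family ε
      U , A , U≤ = evensFor L₀ even
  in finish L₀ (map oddLength gs)
       (insertEvens c bounded (≤-trans (m≤m+n 2 1) (m≤m⊔n 3
         (7 ^ (length (map oddLength gs) + a ∸ 1) * (2 * maxL (map oddLength gs) + 1))))
         A U≤ (ε₀-frontier L₀) (m≤m⊔n 1 (2 * length L₀ * (maxL L₀ + 3) ∸ 1)))
       Ls↭ N₀≡₂ε

open import Data.Integer using (+_)

theorem5p9 : (L₀ L₁ : List ℕ) (a : ℕ) →
    All (λ ℓ → Even ℓ × ℓ > 2) L₀ →
    All (λ ℓ → Odd ℓ × ℓ > 2) L₁ →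
    a ≤ 1 →
    (ε : ℕ) → 6 * ε₀ L₀ + 7 * ε₁ L₁ a + 9 ≤ ε →
    Σ (Labeling L₀ L₁ a (ε ∸ sum (L₀ ++ L₁) ∸ 2 * a)) λ Γ →
    IsGraceful Γ ×
    map +_ (I (4 * ε₀ L₀ + 5 * ε₁ L₁ a + 7) ε) ⊆ₘ Labeling.ΔpΓ Γ
theorem5p9 L₀ L₁ a even odd a≤1 ε h = go (oddHalves L₁ odd) h
  where
  go : (Σ (List ℕ) λ gs → L₁ ≡ map oddLength gs) → 6 * ε₀ L₀ + 7 * ε₁ L₁ a + 9 ≤ ε →
    Σ (Labeling L₀ L₁ a (ε ∸ sum (L₀ ++ L₁) ∸ 2 * a)) λ Γ →
      IsGraceful Γ × map pos (I (4 * ε₀ L₀ + 5 * ε₁ L₁ a + 7) ε) ⊆ₘ Labeling.ΔpΓ Γ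
  go (gs , refl) = theorem-halves L₀ gs a even a≤1 ε
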